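{- Let $N$ and $d$ be positive integers. If there exists an amicable pair of $2N\times 2N$ Hadamard matrices and there exists a $d\times 2d$ equiangular tight frame, then there exists a $2dN\times 4dN$ equiangular tight frame.
   Context: A $d\times n$ equiangular tight frame (ETF) is a collection of $n$ unit vectors $x_1,\dots,x_n$ in $\mathbb{C}^d$ attaining the Welch bound, i.e. $\max_{i\neq j}|\langle x_i,x_j\rangle|^2=\frac{n-d}{d(n-1)}$. A Hadamard matrix of order $n$ is an $n\times n$ matrix $H$ with entries $\pm1$ and $HH^{\mathrm T}=nI_n$. It is symmetric if $H=H^{\mathrm T}$ and skew Hadamard if $H=C+I_n$ with $C^{\mathrm T}=-C$. A pair $(A,B)$ of Hadamard matrices of the same order is amicable if $A$ is symmetric, $B$ is skew Hadamard, and $AB^{\mathrm T}=BA^{\mathrm T}$. -}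

module Defs where

open import Algebra.Bundles using (CommutativeMonoid)
open import Algebra.Bundles.Raw using (RawMonoid)
import Algebra.Definitions.RawMonoid as RawMonoidDefs
import Algebra.Properties.CommutativeSemigroup as CommutativeSemigroupProperties
open import Data.Bool.Base using (if_then_else_)
open import Data.Fin.Base using (Fin)
import Data.Fin.Properties as Fin
open import Data.Integer.Base as ℤ using (ℤ; +_; 0ℤ; 1ℤ; -1ℤ)
open import Data.Nat.Base as ℕ using (ℕ; NonZero; NonTrivial; 2+)
import Data.Nat.Properties as ℕ
open import Data.Product.Base using (∃; ∃₂; ∃-syntax; _×_; _,_; proj₁; proj₂)
open import Data.Rational.Base as ℚ using (ℚ; 0ℚ; 1ℚ; ½; ∣_∣; 1/_)
import Data.Rational.Properties as ℚ
open import Data.Sum.Base using (_⊎_)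
open import Data.Vec.Functional using (Vector)
open import Level using (0ℓ)
open import Relation.Binary.PropositionalEquality
  using (_≡_; _≢_; refl; sym; trans; cong; cong₂; subst; subst₂; module ≡-Reasoning)
open import Relation.Nullary.Decidable using (does)

IsCauchy : (ℕ → ℚ) → Set
IsCauchy s = ∀ {ε} → 0ℚ ℚ.< ε →
  ∃[ N ] (∀ {m n} → N ℕ.≤ m → N ℕ.≤ n → ∣ s m ℚ.- s n ∣ ℚ.< ε)

private

  open CommutativeSemigroupProperties
    (CommutativeMonoid.commutativeSemigroup ℚ.+-0-commutativeMonoid)
    using (interchange)

  ½*-pos : ∀ {ε} → 0ℚ ℚ.< ε → 0ℚ ℚ.< ½ ℚ.* ε
  ½*-pos {ε} 0<ε = ℚ.positive⁻¹ (½ ℚ.* ε) {{ℚ.pos*pos⇒pos ½ ε {{ℚ.positive 0<ε}}}}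

  ½+½ : ∀ ε → ½ ℚ.* ε ℚ.+ ½ ℚ.* ε ≡ ε
  ½+½ ε = trans (sym (ℚ.*-distribʳ-+ ε ½ ½)) (ℚ.*-identityˡ ε)

  -- Abstract, so that typechecking never unfolds these moduli.
  abstract

    const-cauchy : ∀ q → IsCauchy (λ _ → q)
    const-cauchy q {ε} 0<ε =
      0 , λ _ _ → subst (λ t → ∣ t ∣ ℚ.< ε) (sym (ℚ.+-inverseʳ q)) 0<ε

    neg-cauchy : ∀ s → IsCauchy s → IsCauchy (λ n → ℚ.- s n)
    neg-cauchy s c {ε} 0<ε with c 0<ε
    ... | N , h = N , λ {m} {n} N≤m N≤n →
      subst (ℚ._< ε) (trans (sym (ℚ.∣-p∣≡∣p∣ (s m ℚ.- s n)))
                            (cong ∣_∣ (ℚ.neg-distrib-+ (s m) (ℚ.- s n))))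
            (h N≤m N≤n)

    +-cauchy : ∀ s t → IsCauchy s → IsCauchy t → IsCauchy (λ n → s n ℚ.+ t n)
    +-cauchy s t c d {ε} 0<ε with c (½*-pos 0<ε) | d (½*-pos 0<ε)
    ... | M , g | N , h = M ℕ.⊔ N , λ {m} {n} ≤m ≤n →
      let open ℚ.≤-Reasoning in begin-strict
        ∣ (s m ℚ.+ t m) ℚ.- (s n ℚ.+ t n) ∣
          ≡⟨ cong ∣_∣ (rearrange (s m) (t m) (s n) (t n)) ⟩
        ∣ (s m ℚ.- s n) ℚ.+ (t m ℚ.- t n) ∣
          ≤⟨ ℚ.∣p+q∣≤∣p∣+∣q∣ (s m ℚ.- s n) (t m ℚ.- t n) ⟩
        ∣ s m ℚ.- s n ∣ ℚ.+ ∣ t m ℚ.- t n ∣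
          <⟨ ℚ.+-mono-< (g (ℕ.m⊔n≤o⇒m≤o M N ≤m) (ℕ.m⊔n≤o⇒m≤o M N ≤n))
                        (h (ℕ.m⊔n≤o⇒n≤o M N ≤m) (ℕ.m⊔n≤o⇒n≤o M N ≤n)) ⟩
        ½ ℚ.* ε ℚ.+ ½ ℚ.* ε
          ≡⟨ ½+½ ε ⟩
        ε ∎
      where
      rearrange : ∀ a b a′ b′ →
        (a ℚ.+ b) ℚ.- (a′ ℚ.+ b′) ≡ (a ℚ.- a′) ℚ.+ (b ℚ.- b′)
      rearrange a b a′ b′ = trans
        (cong (λ t → (a ℚ.+ b) ℚ.+ t) (ℚ.neg-distrib-+ a′ b′))
        (interchange a b (ℚ.- a′) (ℚ.- b′))

    insert : ∀ a b → a ≡ (a ℚ.- b) ℚ.+ b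
    insert a b = sym (trans (ℚ.+-assoc a (ℚ.- b) b)
                     (trans (cong (a ℚ.+_) (ℚ.+-inverseˡ b)) (ℚ.+-identityʳ a)))

    eventually-bounded : ∀ s → IsCauchy s →
      ∃[ K ] 0ℚ ℚ.< K × ∃[ N ] (∀ {n} → N ℕ.≤ n → ∣ s n ∣ ℚ.≤ K)
    eventually-bounded s c with c (ℚ.positive⁻¹ 1ℚ)
    ... | N , h = 1ℚ ℚ.+ ∣ s N ∣ , 0<K , N , bound
      where
      0<K : 0ℚ ℚ.< 1ℚ ℚ.+ ∣ s N ∣
      0<K = ℚ.+-mono-<-≤ (ℚ.positive⁻¹ 1ℚ) (ℚ.0≤∣p∣ (s N))
      bound : ∀ {n} → N ℕ.≤ n → ∣ s n ∣ ℚ.≤ 1ℚ ℚ.+ ∣ s N ∣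
      bound {n} N≤n = let open ℚ.≤-Reasoning in begin
        ∣ s n ∣
          ≡⟨ cong ∣_∣ (insert (s n) (s N)) ⟩
        ∣ (s n ℚ.- s N) ℚ.+ s N ∣
          ≤⟨ ℚ.∣p+q∣≤∣p∣+∣q∣ (s n ℚ.- s N) (s N) ⟩
        ∣ s n ℚ.- s N ∣ ℚ.+ ∣ s N ∣
          ≤⟨ ℚ.+-monoˡ-≤ ∣ s N ∣ (ℚ.<⇒≤ (h N≤n ℕ.≤-refl)) ⟩
        1ℚ ℚ.+ ∣ s N ∣ ∎

    divide : ∀ {K ε} → 0ℚ ℚ.< K → 0ℚ ℚ.< ε → ∃[ δ ] 0ℚ ℚ.< δ × K ℚ.* δ ≡ ε
    divide {K} {ε} 0<K 0<ε = δ , 0<δ , K*δ≡ε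
      where
      instance
        K-pos : ℚ.Positive K
        K-pos = ℚ.positive 0<K
        ε-pos : ℚ.Positive ε
        ε-pos = ℚ.positive 0<ε
        K-nonZero : ℚ.NonZero K
        K-nonZero = ℚ.pos⇒nonZero K
      δ : ℚ
      δ = 1/ K ℚ.* ε
      0<δ : 0ℚ ℚ.< δ
      0<δ = ℚ.positive⁻¹ δ {{ℚ.pos*pos⇒pos (1/ K) {{ℚ.1/pos⇒pos K}} ε}}
      K*δ≡ε : K ℚ.* δ ≡ ε
      K*δ≡ε = trans (sym (ℚ.*-assoc K (1/ K) ε))
              (trans (cong (ℚ._* ε) (ℚ.*-inverseʳ K)) (ℚ.*-identityˡ ε))

    *-cauchy : ∀ s t → IsCauchy s → IsCauchy t → IsCauchy (λ n → s n ℚ.* t n)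
    *-cauchy s t c d {ε} 0<ε
      with eventually-bounded s c | eventually-bounded t d
    ... | K , 0<K , M₁ , s≤K | L , 0<L , N₁ , t≤L
      with divide 0<K (½*-pos 0<ε) | divide 0<L (½*-pos 0<ε)
    ... | δ , 0<δ , Kδ | η , 0<η , Lη
      with c 0<η | d 0<δ
    ... | M₂ , g | N₂ , h = (M₁ ℕ.⊔ N₁) ℕ.⊔ (M₂ ℕ.⊔ N₂) , λ {m} {n} ≤m ≤n →
      let open ℚ.≤-Reasoning
          B  = M₁ ℕ.⊔ N₁
          C  = M₂ ℕ.⊔ N₂
          ≤m₁ = ℕ.m⊔n≤o⇒m≤o B C ≤m
          ≤n₁ = ℕ.m⊔n≤o⇒m≤o B C ≤n
          ≤m₂ = ℕ.m⊔n≤o⇒n≤o B C ≤m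
          ≤n₂ = ℕ.m⊔n≤o⇒n≤o B C ≤n
      in begin-strict
        ∣ s m ℚ.* t m ℚ.- s n ℚ.* t n ∣
          ≡⟨ cong ∣_∣ (rearrange (s m) (t m) (s n) (t n)) ⟩
        ∣ s m ℚ.* (t m ℚ.- t n) ℚ.+ (s m ℚ.- s n) ℚ.* t n ∣
          ≤⟨ ℚ.∣p+q∣≤∣p∣+∣q∣ (s m ℚ.* (t m ℚ.- t n)) ((s m ℚ.- s n) ℚ.* t n) ⟩
        ∣ s m ℚ.* (t m ℚ.- t n) ∣ ℚ.+ ∣ (s m ℚ.- s n) ℚ.* t n ∣
          <⟨ ℚ.+-mono-<
               (small (s m) (t m ℚ.- t n) 0<K (s≤K (ℕ.m⊔n≤o⇒m≤o M₁ N₁ ≤m₁))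
                  (h (ℕ.m⊔n≤o⇒n≤o M₂ N₂ ≤m₂) (ℕ.m⊔n≤o⇒n≤o M₂ N₂ ≤n₂)))
               (subst₂ ℚ._<_ (cong ∣_∣ (ℚ.*-comm (t n) (s m ℚ.- s n))) refl
                 (small (t n) (s m ℚ.- s n) 0<L (t≤L (ℕ.m⊔n≤o⇒n≤o M₁ N₁ ≤n₁))
                    (g (ℕ.m⊔n≤o⇒m≤o M₂ N₂ ≤m₂) (ℕ.m⊔n≤o⇒m≤o M₂ N₂ ≤n₂)))) ⟩
        K ℚ.* δ ℚ.+ L ℚ.* η
          ≡⟨ cong₂ ℚ._+_ Kδ Lη ⟩
        ½ ℚ.* ε ℚ.+ ½ ℚ.* ε
          ≡⟨ ½+½ ε ⟩
        ε ∎
      where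
      rearrange : ∀ a b a′ b′ →
        a ℚ.* b ℚ.- a′ ℚ.* b′ ≡ a ℚ.* (b ℚ.- b′) ℚ.+ (a ℚ.- a′) ℚ.* b′
      rearrange a b a′ b′ = let open ≡-Reasoning in begin
        a ℚ.* b ℚ.- a′ ℚ.* b′
          ≡⟨ cong (ℚ._- a′ ℚ.* b′) (insert (a ℚ.* b) (a ℚ.* b′)) ⟩
        (a ℚ.* b ℚ.- a ℚ.* b′ ℚ.+ a ℚ.* b′) ℚ.- a′ ℚ.* b′
          ≡⟨ ℚ.+-assoc (a ℚ.* b ℚ.- a ℚ.* b′) (a ℚ.* b′) (ℚ.- (a′ ℚ.* b′)) ⟩
        (a ℚ.* b ℚ.- a ℚ.* b′) ℚ.+ (a ℚ.* b′ ℚ.- a′ ℚ.* b′)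
          ≡⟨ cong₂ (λ p q → (a ℚ.* b ℚ.+ p) ℚ.+ (a ℚ.* b′ ℚ.+ q))
                   (ℚ.neg-distribʳ-* a b′) (ℚ.neg-distribˡ-* a′ b′) ⟩
        (a ℚ.* b ℚ.+ a ℚ.* (ℚ.- b′)) ℚ.+ (a ℚ.* b′ ℚ.+ (ℚ.- a′) ℚ.* b′)
          ≡⟨ cong₂ ℚ._+_ (sym (ℚ.*-distribˡ-+ a b (ℚ.- b′)))
                         (sym (ℚ.*-distribʳ-+ b′ a (ℚ.- a′))) ⟩
        a ℚ.* (b ℚ.- b′) ℚ.+ (a ℚ.- a′) ℚ.* b′ ∎
      small : ∀ p q {K δ} → 0ℚ ℚ.< K → ∣ p ∣ ℚ.≤ K → ∣ q ∣ ℚ.< δ → ∣ p ℚ.* q ∣ ℚ.< K ℚ.* δ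
      small p q {K} {δ} 0<K p≤K q<δ = let open ℚ.≤-Reasoning in begin-strict
        ∣ p ℚ.* q ∣
          ≡⟨ ℚ.∣p*q∣≡∣p∣*∣q∣ p q ⟩
        ∣ p ∣ ℚ.* ∣ q ∣
          ≤⟨ ℚ.*-monoʳ-≤-nonNeg ∣ q ∣ {{ℚ.∣-∣-nonNeg q}} p≤K ⟩
        K ℚ.* ∣ q ∣
          <⟨ ℚ.*-monoʳ-<-pos K {{ℚ.positive 0<K}} q<δ ⟩
        K ℚ.* δ ∎

infix  4 _≃ᴿ_ _≤ᴿ_
infixl 6 _+ᴿ_ _-ᴿ_
infixl 7 _*ᴿ_
infix  8 -ᴿ_

-- Compared by _≃ᴿ_, never by _≡_: a real is an equivalence class of sequences.
record ℝ : Set where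
  constructor mkℝ
  field
    seq    : ℕ → ℚ
    cauchy : IsCauchy seq

open ℝ public

record _≃ᴿ_ (x y : ℝ) : Set where
  constructor mk≃ᴿ
  field
    close : ∀ {ε} → 0ℚ ℚ.< ε →
      ∃[ N ] (∀ {n} → N ℕ.≤ n → ∣ seq x n ℚ.- seq y n ∣ ℚ.< ε)

record _≤ᴿ_ (x y : ℝ) : Set where
  constructor mk≤ᴿ
  field
    below : ∀ {ε} → 0ℚ ℚ.< ε →
      ∃[ N ] (∀ {n} → N ℕ.≤ n → seq x n ℚ.< seq y n ℚ.+ ε)

fromℚ : ℚ → ℝ
fromℚ q = mkℝ (λ _ → q) (const-cauchy q)

0ᴿ 1ᴿ : ℝ
0ᴿ = fromℚ 0ℚ
1ᴿ = fromℚ 1ℚ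

_+ᴿ_ _*ᴿ_ : ℝ → ℝ → ℝ
x +ᴿ y = mkℝ (λ n → seq x n ℚ.+ seq y n) (+-cauchy (seq x) (seq y) (cauchy x) (cauchy y))
x *ᴿ y = mkℝ (λ n → seq x n ℚ.* seq y n) (*-cauchy (seq x) (seq y) (cauchy x) (cauchy y))

-ᴿ_ : ℝ → ℝ
-ᴿ x = mkℝ (λ n → ℚ.- seq x n) (neg-cauchy (seq x) (cauchy x))

_-ᴿ_ : ℝ → ℝ → ℝ
x -ᴿ y = x +ᴿ (-ᴿ y)

record IsMaximum {I : Set} (f : I → ℝ) (c : ℝ) : Set where
  field
    attained   : ∃[ i ] f i ≃ᴿ c
    upperBound : ∀ i → f i ≤ᴿ c

infix  4 _≃ᶜ_
infixl 6 _+ᶜ_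
infixl 7 _*ᶜ_

record ℂ : Set where
  constructor _+i_
  field
    re im : ℝ

open ℂ public

record _≃ᶜ_ (z w : ℂ) : Set where
  constructor mk≃ᶜ
  field
    re-≃ : re z ≃ᴿ re w
    im-≃ : im z ≃ᴿ im w

0ᶜ 1ᶜ : ℂ
0ᶜ = 0ᴿ +i 0ᴿ
1ᶜ = 1ᴿ +i 0ᴿ

_+ᶜ_ _*ᶜ_ : ℂ → ℂ → ℂ
(a +i b) +ᶜ (c +i d) = (a +ᴿ c) +i (b +ᴿ d)
(a +i b) *ᶜ (c +i d) = (a *ᴿ c -ᴿ b *ᴿ d) +i (a *ᴿ d +ᴿ b *ᴿ c)

conj : ℂ → ℂ
conj (a +i b) = a +i (-ᴿ b)

∣_∣² : ℂ → ℝ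
∣ a +i b ∣² = a *ᴿ a +ᴿ b *ᴿ b

+ᶜ-rawMonoid : RawMonoid 0ℓ 0ℓ
+ᶜ-rawMonoid = record { Carrier = ℂ ; _≈_ = _≃ᶜ_ ; _∙_ = _+ᶜ_ ; ε = 0ᶜ }

∑ᶜ : ∀ {n} → Vector ℂ n → ℂ
∑ᶜ = RawMonoidDefs.sum +ᶜ-rawMonoid

⟨_,_⟩ : ∀ {d} → Vector ℂ d → Vector ℂ d → ℂ
⟨ x , y ⟩ = ∑ᶜ (λ k → x k *ᶜ conj (y k))

private
  n∸1-nonZero : ∀ n → .{{NonTrivial n}} → NonZero (n ℕ.∸ 1)
  n∸1-nonZero (2+ n) = _

  d*[n∸1]-nonZero : ∀ d n → .{{NonZero d}} → .{{NonTrivial n}} →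
    NonZero (d ℕ.* (n ℕ.∸ 1))
  d*[n∸1]-nonZero d n = ℕ.m*n≢0 d (n ℕ.∸ 1)
    where
    instance
      n∸1≢0 : NonZero (n ℕ.∸ 1)
      n∸1≢0 = n∸1-nonZero n

-- The Welch bound on ∣⟨xᵢ,xⱼ⟩∣ is the square root of this.
welchBound² : ∀ d n → .{{NonZero d}} → .{{NonTrivial n}} → ℚ
welchBound² d n =
  ((+ n ℤ.- + d) ℚ./ (d ℕ.* (n ℕ.∸ 1))) {{d*[n∸1]-nonZero d n}}

-- The first two fields are what makes the Welch bound well defined.
record IsETF {d n : ℕ} (x : Vector (Vector ℂ d) n) : Set where
  field
    {{d≥1}} : NonZero d
    {{n≥2}} : NonTrivial n
    unit    : ∀ i → ⟨ x i , x i ⟩ ≃ᶜ 1ᶜ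
    welch   : IsMaximum {I = ∃₂ λ (i j : Fin n) → i ≢ j}
                (λ (i , j , _) → ∣ ⟨ x i , x j ⟩ ∣²)
                (fromℚ (welchBound² d n))

ETF : ℕ → ℕ → Set
ETF d n = ∃[ x ] IsETF {d} {n} x

infix  4 _≋_
infixl 6 _⊕_
infixl 7 _⊛_ _·_
infix  8 ⊝_
infix  9 _ᵀ

Matrix : ℕ → Set
Matrix n = Fin n → Fin n → ℤ

_≋_ : ∀ {n} → Matrix n → Matrix n → Set
A ≋ B = ∀ i j → A i j ≡ B i j

_⊕_ _⊛_ : ∀ {n} → Matrix n → Matrix n → Matrix n
(A ⊕ B) i j = A i j ℤ.+ B i j
(A ⊛ B) i j = RawMonoidDefs.sum ℤ.+-0-rawMonoid (λ k → A i k ℤ.* B k j)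

_·_ : ∀ {n} → ℤ → Matrix n → Matrix n
(c · A) i j = c ℤ.* A i j

⊝_ : ∀ {n} → Matrix n → Matrix n
(⊝ A) i j = ℤ.- A i j

_ᵀ : ∀ {n} → Matrix n → Matrix n
(A ᵀ) i j = A j i

𝕀 : ∀ {n} → Matrix n
𝕀 i j = if does (i Fin.≟ j) then 1ℤ else 0ℤ

record IsHadamard {n : ℕ} (H : Matrix n) : Set where
  field
    entries    : ∀ i j → H i j ≡ 1ℤ ⊎ H i j ≡ -1ℤ
    orthogonal : H ⊛ H ᵀ ≋ + n · 𝕀

IsSymmetric : ∀ {n} → Matrix n → Set
IsSymmetric H = H ≋ H ᵀ

IsSkewHadamard : ∀ {n} → Matrix n → Set
IsSkewHadamard H = IsHadamard H × ∃[ C ] (H ≋ C ⊕ 𝕀 × C ᵀ ≋ ⊝ C)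

record IsAmicable {n : ℕ} (A B : Matrix n) : Set where
  field
    A-hadamard  : IsHadamard A
    A-symmetric : IsSymmetric A
    B-skew      : IsSkewHadamard B
    amicable    : A ⊛ B ᵀ ≋ B ⊛ A ᵀ

AmicablePair : ℕ → Set
AmicablePair n = ∃₂ λ (A B : Matrix n) → IsAmicable A B

{-# OPTIONS --safe #-}

-- Write n = 2d for the number of vectors of the given frame and G for its Gram matrix.  Equality
-- in the Welch bound forces G² = 2G, so that h = G − I is Hermitian with h² = I and all its
-- off-diagonal entries have the same modulus.  If A and B = C + I are the amicable Hadamard
-- matrices of order m = 2N, then amicability says that AC + CA = 0, so for suitable real α, β
-- the matrix S = α h ⊗ A + iβ I ⊗ C again is Hermitian, squares to I and has zero diagonal and
-- off-diagonal entries of constant modulus.  Now I + S = 2P for an orthogonal projection P of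
-- rank nm/2, which makes I + S the Gram matrix of nm vectors in dimension nm/2 = 2dN.

module Submission where

open import Defs
open import Algebra.Bundles using (CommutativeRing)
import Algebra.Definitions.RawMonoid as RawMonoidDefs
import Algebra.Properties.Semiring.Sum as SemiringSum
import Algebra.Solver.Ring as RingSolver
open import Algebra.Solver.Ring.AlmostCommutativeRing
  using (fromCommutativeRing; _-Raw-AlmostCommutative⟶_)
open import Data.Fin.Base using (Fin; zero; suc; combine; remQuot; _↑ˡ_; _↑ʳ_)
import Data.Fin.Properties as Fin
open import Data.Integer.Base as ℤ using (ℤ; +_; 0ℤ; 1ℤ; -1ℤ)
import Data.Integer.Properties as ℤ
open import Data.Maybe.Base as Maybe using (Maybe)
open import Data.Nat.Base as ℕ using (ℕ; zero; suc; NonZero; NonTrivial)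
import Data.Nat.Properties as ℕ
import Data.Nat.Solver as ℕ
open import Data.Product.Base
  using (∃; ∃₂; ∃-syntax; _×_; _,_; proj₁; proj₂; uncurry; map₁)
open import Data.Rational.Base as ℚ using (ℚ; mkℚ; 0ℚ; 1ℚ; ½; ∣_∣; 1/_)
import Data.Rational.Properties as ℚ
import Data.Rational.Solver as ℚ
import Data.Rational.Unnormalised.Base as ℚᵘ
import Data.Rational.Unnormalised.Properties as ℚᵘ
open import Data.Sum.Base using (_⊎_; inj₁; inj₂; [_,_]′)
open import Data.Vec.Functional using (Vector; _∷_)
open import Function.Base using (_∘_)
open import Level using (0ℓ)
open import Relation.Binary.PropositionalEquality as ≡ using (_≡_; _≢_)
import Relation.Binary.Reasoning.Setoid as SetoidReasoning
open import Relation.Nullary.Decidable using (yes; no; dec-true; dec-false; dec⇒maybe)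
open import Relation.Nullary.Negation using (contradiction)

-- Since n = 2d, the squared Welch bound is w = 1/(n - 1) for the given frame and w′ = 1/(nm - 1)
-- for the new one. The moduli force both constants: an entry in a block with i ≠ j has squared
-- modulus α² w, an off-diagonal entry in a block with i = j has β², and both must be w′. So α² = (n
-- - 1) w′ and β² = w′. Then S² = I follows, as the coefficient of I is w′ ((n - 1) m + (m - 1)) =
-- w′ (nm - 1) = 1. The factor i is there because C is real and skew, so that iC is Hermitian.
--
-- The obstacle is that reals are Cauchy sequences, so rank and elimination cannot rest on deciding
-- which entries vanish. The trace takes their place: a trace 2r with r ≥ 1 keeps some diagonal
-- entry away from zero, which gives a pivot, and a trace 0 forces a Hermitian M with M² = 2M to
-- vanish. In the same spirit the equality case of the Welch bound is settled by a vanishing sum of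
-- nonnegative terms, with no appeal to eigenvalues.

-- What the construction needs of ℂ.  Whether a given number is zero is undecidable, so pivot has
-- to find an invertible term in a sum known to be nonzero.  Constants are written int z, also for
-- 0 and 1, as these are the constants that the ring solver knows.
record ComplexNumbers : Set₁ where
  infix 9 _⋆
  field
    commutativeRing : CommutativeRing 0ℓ 0ℓ
  open CommutativeRing commutativeRing public hiding (zero)
  open SemiringSum semiring public
  field
    _⋆         : Carrier → Carrier
    ⋆-cong     : ∀ {x y} → x ≈ y → x ⋆ ≈ y ⋆
    ⋆-+        : ∀ x y → (x + y) ⋆ ≈ x ⋆ + y ⋆
    ⋆-*        : ∀ x y → (x * y) ⋆ ≈ x ⋆ * y ⋆
    ⋆-⋆        : ∀ x → x ⋆ ⋆ ≈ x
    int        : ℤ → Carrier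
    int-+      : ∀ a b → int (a ℤ.+ b) ≈ int a + int b
    int-*      : ∀ a b → int (a ℤ.* b) ≈ int a * int b
    int-neg    : ∀ a → int (ℤ.- a) ≈ - int a
    int-0      : int 0ℤ ≈ 0#
    int-1      : int 1ℤ ≈ 1#
    int-⋆      : ∀ a → int a ⋆ ≈ int a
    imag       : Carrier
    imag²      : imag * imag ≈ int -1ℤ
    imag-⋆     : imag ⋆ ≈ - imag
    NonNeg     : Carrier → Set
    nonNeg-resp : ∀ {x y} → x ≈ y → NonNeg x → NonNeg y
    nonNeg-+   : ∀ {x y} → NonNeg x → NonNeg y → NonNeg (x + y)
    nonNeg-⋆   : ∀ x → NonNeg (x * x ⋆)
    vanish     : ∀ {x y} → NonNeg x → NonNeg y → x + y ≈ 0# → x ≈ 0#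
    definite   : ∀ x → x * x ⋆ ≈ 0# → x ≈ 0#
    pivot      : ∀ {n} (f : Vector Carrier n) → (∀ i → f i ⋆ ≈ f i) →
                 ∀ r → sum f ≈ int (+ suc r) →
                 ∃₂ λ i c → c ⋆ ≈ c × (c * c) * f i ≈ int 1ℤ

module Frames (K : ComplexNumbers) where
  open ComplexNumbers K
  open SetoidReasoning setoid

  private
    int-morphism : ℤ.+-*-rawRing -Raw-AlmostCommutative⟶ fromCommutativeRing commutativeRing
    int-morphism = record
      { ⟦_⟧ = int ; +-homo = int-+ ; *-homo = int-* ; -‿homo = int-neg
      ; 0-homo = int-0 ; 1-homo = int-1 }

    int-≟ : ∀ a b → Maybe (int a ≈ int b)
    int-≟ a b = Maybe.map (λ a≡b → reflexive (≡.cong int a≡b)) (dec⇒maybe (a ℤ.≟ b))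

    module Solver = RingSolver ℤ.+-*-rawRing (fromCommutativeRing commutativeRing) int-morphism int-≟
  open Solver hiding (⟦_⟧)

  -- Finite sums, the Kronecker delta and vanishing sums of nonnegative terms

  0-⋆ : 0# ⋆ ≈ 0#
  0-⋆ = trans (⋆-cong (sym int-0)) (trans (int-⋆ 0ℤ) int-0)

  sum-⋆ : ∀ {n} (f : Vector Carrier n) → (sum f) ⋆ ≈ ∑[ i < n ] (f i ⋆)
  sum-⋆ {zero}  f = 0-⋆
  sum-⋆ {suc n} f = trans (⋆-+ _ _) (+-congˡ (sum-⋆ (f ∘ suc)))

  neg-⋆ : ∀ x → (- x) ⋆ ≈ - (x ⋆)
  neg-⋆ x = begin
    (- x) ⋆            ≈⟨ ⋆-cong (solve 1 (λ x → :- x := con -1ℤ :* x) refl x) ⟩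
    (int -1ℤ * x) ⋆    ≈⟨ ⋆-* _ _ ⟩
    int -1ℤ ⋆ * x ⋆    ≈⟨ *-congʳ (int-⋆ _) ⟩
    int -1ℤ * x ⋆      ≈⟨ solve 1 (λ x → con -1ℤ :* x := :- x) refl (x ⋆) ⟩
    - (x ⋆)            ∎

  sum-int : ∀ {n} (f : Vector ℤ n) →
    int (RawMonoidDefs.sum ℤ.+-0-rawMonoid f) ≈ ∑[ i < n ] int (f i)
  sum-int {zero}  f = int-0
  sum-int {suc n} f = trans (int-+ _ _) (+-congˡ (sum-int (f ∘ suc)))

  sum-cong : ∀ n {f g : Vector Carrier n} → (∀ i → f i ≈ g i) → sum f ≈ sum g
  sum-cong n = sum-cong-≋ {n}

  -- A product of two binomials expands into four terms, so one law of this shape serves all the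
  -- expansions below. Shorter expansions are padded with the coefficient `int 0ℤ`.
  sum-lin : ∀ {n} x y z w (f g h k : Vector Carrier n) →
    ∑[ i < n ] (x * f i + y * g i + z * h i + w * k i) ≈
    x * sum f + y * sum g + z * sum h + w * sum k
  sum-lin {n} x y z w f g h k = begin
    ∑[ i < n ] (x * f i + y * g i + z * h i + w * k i)
      ≈⟨ ∑-distrib-+ {n} _ _ ⟩
    ∑[ i < n ] (x * f i + y * g i + z * h i) + ∑[ i < n ] (w * k i)
      ≈⟨ +-congʳ (∑-distrib-+ {n} _ _) ⟩
    ∑[ i < n ] (x * f i + y * g i) + ∑[ i < n ] (z * h i) + ∑[ i < n ] (w * k i)
      ≈⟨ +-congʳ (+-congʳ (∑-distrib-+ {n} _ _)) ⟩
    ∑[ i < n ] (x * f i) + ∑[ i < n ] (y * g i) + ∑[ i < n ] (z * h i) + ∑[ i < n ] (w * k i)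
      ≈⟨ +-cong (+-cong (+-cong (*-distribˡ-sum x f) (*-distribˡ-sum y g)) (*-distribˡ-sum z h))
           (*-distribˡ-sum w k) ⟨
    x * sum f + y * sum g + z * sum h + w * sum k ∎

  sum-const : ∀ n x → ∑[ i < n ] x ≈ int (+ n) * x
  sum-const zero    x = sym (trans (*-congʳ int-0) (zeroˡ x))
  sum-const (suc n) x = begin
    x + ∑[ i < n ] x            ≈⟨ +-congˡ (sum-const n x) ⟩
    x + int (+ n) * x           ≈⟨ solve 2 (λ x m → x :+ m :* x := (con 1ℤ :+ m) :* x) refl x _ ⟩
    (int 1ℤ + int (+ n)) * x    ≈⟨ *-congʳ (int-+ 1ℤ (+ n)) ⟨
    int (+ suc n) * x           ∎

  sum-0 : ∀ {n} (f : Vector Carrier n) → (∀ i → f i ≈ 0#) → sum f ≈ 0#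
  sum-0 {n} f f≈0 = trans (sum-cong n f≈0) (sum-replicate-zero n)

  -- Taken from the integer matrix `𝕀`, so that the Hadamard equations map to it under `int` as they
  -- stand, and a case split on `i Fin.≟ j` makes it compute.
  δ : ∀ {n} → Fin n → Fin n → Carrier
  δ i j = int (𝕀 i j)

  δ-refl : ∀ {n} (i : Fin n) → δ i i ≈ int 1ℤ
  δ-refl i rewrite dec-true (i Fin.≟ i) ≡.refl = refl

  δ-≢ : ∀ {n} {i j : Fin n} → i ≢ j → δ i j ≈ int 0ℤ
  δ-≢ {i = i} {j} i≢j rewrite dec-false (i Fin.≟ j) i≢j = refl

  δ-sym : ∀ {n} (i j : Fin n) → δ i j ≈ δ j i
  δ-sym i j with i Fin.≟ j
  ... | yes ≡.refl = sym (δ-refl i)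
  ... | no  i≢j    = sym (δ-≢ (i≢j ∘ ≡.sym))

  sum-δ : ∀ {n} i (f : Vector Carrier n) → ∑[ k < n ] (δ i k * f k) ≈ f i
  sum-δ {suc n} zero f = begin
    int 1ℤ * f zero + ∑[ k < n ] (int 0ℤ * f (suc k))
      ≈⟨ +-congˡ (sum-0 {n} _ (λ k → trans (*-congʳ int-0) (zeroˡ _))) ⟩
    int 1ℤ * f zero + 0#
      ≈⟨ trans (+-identityʳ _) (trans (*-congʳ int-1) (*-identityˡ _)) ⟩
    f zero ∎
  sum-δ {suc n} (suc i) f = begin
    -- `δ (suc i) (suc k)` reduces to `δ i k`.
    int 0ℤ * f zero + ∑[ k < n ] (δ i k * f (suc k))
      ≈⟨ +-cong (trans (*-congʳ int-0) (zeroˡ _)) (sum-δ i (f ∘ suc)) ⟩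
    0# + f (suc i)
      ≈⟨ +-identityˡ _ ⟩
    f (suc i) ∎

  sum-δʳ : ∀ {n} i (f : Vector Carrier n) → ∑[ k < n ] (f k * δ k i) ≈ f i
  sum-δʳ {n} i f = trans (sum-cong n (λ k → trans (*-comm _ _) (*-congʳ (δ-sym k i)))) (sum-δ i f)

  nonNeg-0 : NonNeg 0#
  nonNeg-0 = nonNeg-resp (zeroˡ _) (nonNeg-⋆ 0#)

  nonNeg-sum : ∀ {n} (f : Vector Carrier n) → (∀ i → NonNeg (f i)) → NonNeg (sum f)
  nonNeg-sum {zero}  f f≥0 = nonNeg-0
  nonNeg-sum {suc n} f f≥0 = nonNeg-+ (f≥0 zero) (nonNeg-sum (f ∘ suc) (f≥0 ∘ suc))

  vanish-sum : ∀ {n} (f : Vector Carrier n) → (∀ i → NonNeg (f i)) → sum f ≈ 0# → ∀ i → f i ≈ 0#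
  vanish-sum f f≥0 ∑≈0 zero    = vanish (f≥0 zero) (nonNeg-sum (f ∘ suc) (f≥0 ∘ suc)) ∑≈0
  vanish-sum f f≥0 ∑≈0 (suc i) = vanish-sum (f ∘ suc) (f≥0 ∘ suc)
    (vanish (nonNeg-sum (f ∘ suc) (f≥0 ∘ suc)) (f≥0 zero) (trans (+-comm _ _) ∑≈0)) i

  vanish-sum₂ : ∀ {m n} (f : Fin m → Fin n → Carrier) → (∀ i j → NonNeg (f i j)) →
    ∑[ i < m ] ∑[ j < n ] f i j ≈ 0# → ∀ i j → f i j ≈ 0#
  vanish-sum₂ f f≥0 ∑≈0 i = vanish-sum (f i) (f≥0 i)
    (vanish-sum _ (λ i → nonNeg-sum (f i) (f≥0 i)) ∑≈0 i)

  sum-product : ∀ {m n} (f : Vector Carrier m) (g : Vector Carrier n) →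
    sum f * sum g ≈ ∑[ i < m ] ∑[ j < n ] (f i * g j)
  sum-product {m} {n} f g = trans (*-distribʳ-sum {m} (sum g) f)
      (sum-cong m (λ i → *-distribˡ-sum {n} (f i) g))

  sum-comm₄ : ∀ {m n} (f : Fin m → Fin m → Fin n → Fin n → Carrier) →
    ∑[ k < m ] ∑[ l < m ] ∑[ i < n ] ∑[ j < n ] f k l i j ≈
    ∑[ i < n ] ∑[ j < n ] ∑[ k < m ] ∑[ l < m ] f k l i j
  sum-comm₄ {m} {n} f = begin
    ∑[ k < m ] ∑[ l < m ] ∑[ i < n ] ∑[ j < n ] f k l i j
      ≈⟨ sum-cong m (λ k → ∑-comm {m} {n} (λ l i → ∑[ j < n ] f k l i j)) ⟩
    ∑[ k < m ] ∑[ i < n ] ∑[ l < m ] ∑[ j < n ] f k l i j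
      ≈⟨ ∑-comm {m} {n} (λ k i → ∑[ l < m ] ∑[ j < n ] f k l i j) ⟩
    ∑[ i < n ] ∑[ k < m ] ∑[ l < m ] ∑[ j < n ] f k l i j
      ≈⟨ sum-cong n (λ i → sum-cong m (λ k → ∑-comm {m} {n} (λ l j → f k l i j))) ⟩
    ∑[ i < n ] ∑[ k < m ] ∑[ j < n ] ∑[ l < m ] f k l i j
      ≈⟨ sum-cong n (λ i → ∑-comm {m} {n} (λ k j → ∑[ l < m ] f k l i j)) ⟩
    ∑[ i < n ] ∑[ j < n ] ∑[ k < m ] ∑[ l < m ] f k l i j ∎

  -- Gram matrices and the equality case of the Welch bound

  gram : ∀ {d n} → (Fin n → Vector Carrier d) → Fin n → Fin n → Carrier
  gram {d} x i j = ∑[ k < d ] (x i k * x j k ⋆)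

  gram-⋆ : ∀ {d n} (x : Fin n → Vector Carrier d) i j → gram x i j ⋆ ≈ ∑[ k < d ] (x i k ⋆ * x j k)
  gram-⋆ {d} x i j = trans (sum-⋆ (λ k → x i k * x j k ⋆))
    (sum-cong d (λ k → trans (⋆-* _ _) (*-congˡ (⋆-⋆ _))))

  gram-hermitian : ∀ {d n} (x : Fin n → Vector Carrier d) i j → gram x i j ⋆ ≈ gram x j i
  gram-hermitian {d} x i j = trans (gram-⋆ x i j) (sum-cong d (λ k → *-comm _ _))

  -- With F the frame operator and G the Gram matrix, ‖F − 2I‖² + Σ (w − |Gᵢⱼ|²) vanishes, where
  -- the diagonal terms of the sum are read as 1 − |Gᵢᵢ|².  All summands are nonnegative, hence 0.
  -- The hypothesis w-eq says w = 1/(n − 1).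
  module WelchEquality {d n} (x : Fin n → Vector Carrier d) (w : Carrier)
    (n≡2d : n ≡ 2 ℕ.* d) (w-eq : int (+ n) * w ≈ int 1ℤ + w)
    (unit : ∀ i → gram x i i ≈ int 1ℤ)
    (bound : ∀ {i j} → i ≢ j → NonNeg (w - gram x i j * gram x i j ⋆)) where

    private
      G : Fin n → Fin n → Carrier
      G = gram x

      F E : Fin d → Fin d → Carrier
      F k l = ∑[ i < n ] (x i k ⋆ * x i l)
      E k l = F k l - int (+ 2) * δ k l

      D : Fin n → Fin n → Carrier
      D i j = w + δ i j * (int 1ℤ - w) - G i j * G i j ⋆

      F-⋆ : ∀ k l → F k l ⋆ ≈ ∑[ i < n ] (x i k * x i l ⋆)
      F-⋆ k l = trans (sum-⋆ (λ i → x i k ⋆ * x i l))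
        (sum-cong n (λ i → trans (⋆-* _ _) (*-congʳ (⋆-⋆ _))))

      trF : ∑[ k < d ] F k k ≈ int (+ n)
      trF = begin
        ∑[ k < d ] ∑[ i < n ] (x i k ⋆ * x i k)
          ≈⟨ ∑-comm {d} {n} (λ k i → x i k ⋆ * x i k) ⟩
        ∑[ i < n ] ∑[ k < d ] (x i k ⋆ * x i k)
          ≈⟨ sum-cong n (λ i → trans (sum-cong d (λ k → *-comm _ _)) (unit i)) ⟩
        ∑[ i < n ] int 1ℤ
          ≈⟨ sum-const n _ ⟩
        int (+ n) * int 1ℤ
          ≈⟨ trans (*-congˡ int-1) (*-identityʳ _) ⟩
        int (+ n) ∎

      Φ : Carrier
      Φ = ∑[ i < n ] ∑[ j < n ] (G i j * G i j ⋆)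

      -- If X has the frame vectors as rows, then F = X*X and G = XX*, so both squared Frobenius
      -- norms are the same fourfold sum with its factors regrouped. This number is the frame
      -- potential.
      frobenius : ∑[ k < d ] ∑[ l < d ] (F k l * F k l ⋆) ≈ Φ
      frobenius = begin
        ∑[ k < d ] ∑[ l < d ] (F k l * F k l ⋆)
          ≈⟨ sum-cong d (λ k → sum-cong d (λ l → trans (*-congˡ (F-⋆ k l))
               (sum-product (λ i → x i k ⋆ * x i l) (λ j → x j k * x j l ⋆)))) ⟩
        ∑[ k < d ] ∑[ l < d ] ∑[ i < n ] ∑[ j < n ] (x i k ⋆ * x i l * (x j k * x j l ⋆))
          ≈⟨ sum-comm₄ (λ k l i j → x i k ⋆ * x i l * (x j k * x j l ⋆)) ⟩
        ∑[ i < n ] ∑[ j < n ] ∑[ k < d ] ∑[ l < d ] (x i k ⋆ * x i l * (x j k * x j l ⋆))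
          ≈⟨ sum-cong n (λ i → sum-cong n (λ j → sum-cong d (λ k → sum-cong d (λ l →
               solve 4 (λ a b c e → a :* b :* (c :* e) := a :* c :* (b :* e)) refl
                 (x i k ⋆) (x i l) (x j k) (x j l ⋆))))) ⟩
        ∑[ i < n ] ∑[ j < n ] ∑[ k < d ] ∑[ l < d ] (x i k ⋆ * x j k * (x i l * x j l ⋆))
          ≈⟨ sum-cong n (λ i → sum-cong n (λ j →
               sum-product (λ k → x i k ⋆ * x j k) (λ l → x i l * x j l ⋆))) ⟨
        ∑[ i < n ] ∑[ j < n ] (∑[ k < d ] (x i k ⋆ * x j k) * G i j)
          ≈⟨ sum-cong n (λ i → sum-cong n (λ j → trans (*-comm _ _) (*-congˡ (sym (gram-⋆ x i j))))) ⟩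
        Φ ∎

      -- ‖F - 2I‖² = ‖F‖² - 4 tr F + 4d, and tr F = tr G = n. The coefficient -4 arises as -2 from F
      -- and -2 from its conjugate.
      ∑E : ∑[ k < d ] ∑[ l < d ] (E k l * E k l ⋆) ≈ Φ - int (+ 4) * int (+ n) + int (+ 4) * int (+ d)
      ∑E = begin
        ∑[ k < d ] ∑[ l < d ] (E k l * E k l ⋆)
          ≈⟨ sum-cong d row ⟩
        ∑[ k < d ] (int 1ℤ * R k + int (ℤ.- + 2) * F k k + int (ℤ.- + 2) * F k k ⋆
            + int (+ 4) * int 1ℤ)
          ≈⟨ sum-lin _ _ _ _ R (λ k → F k k) (λ k → F k k ⋆) (λ _ → int 1ℤ) ⟩
        int 1ℤ * ∑[ k < d ] R k + int (ℤ.- + 2) * ∑[ k < d ] F k k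
          + int (ℤ.- + 2) * ∑[ k < d ] (F k k ⋆) + int (+ 4) * ∑[ k < d ] int 1ℤ
          ≈⟨ +-cong (+-cong (+-cong (*-congˡ frobenius) (*-congˡ trF))
               (*-congˡ (trans (sym (sum-⋆ (λ k → F k k))) (trans (⋆-cong trF) (int-⋆ _)))))
               (*-congˡ (sum-const d _)) ⟩
        int 1ℤ * Φ + int (ℤ.- + 2) * int (+ n) + int (ℤ.- + 2) * int (+ n)
            + int (+ 4) * (int (+ d) * int 1ℤ)
          ≈⟨ solve 3 (λ f n d → con 1ℤ :* f :+ con (ℤ.- + 2) :* n :+ con (ℤ.- + 2) :* n
               :+ con (+ 4) :* (d :* con 1ℤ)
               := f :- con (+ 4) :* n :+ con (+ 4) :* d) refl Φ _ _ ⟩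
        Φ - int (+ 4) * int (+ n) + int (+ 4) * int (+ d) ∎
        where
        R : Fin d → Carrier
        R k = ∑[ l < d ] (F k l * F k l ⋆)
        row : ∀ k → ∑[ l < d ] (E k l * E k l ⋆) ≈
          int 1ℤ * R k + int (ℤ.- + 2) * F k k + int (ℤ.- + 2) * F k k ⋆ + int (+ 4) * int 1ℤ
        row k = begin
          ∑[ l < d ] (E k l * E k l ⋆)
            ≈⟨ sum-cong d (λ l → *-congˡ
                 (trans (⋆-+ _ _) (+-congˡ
                 (trans (neg-⋆ _) (-‿cong (trans (⋆-* _ _) (*-cong (int-⋆ _) (int-⋆ _)))))))) ⟩
          ∑[ l < d ] (E k l * (F k l ⋆ - int (+ 2) * δ k l))
            ≈⟨ sum-cong d (λ l → solve 3 (λ f g e → (f :- con (+ 2) :* e) :* (g :- con (+ 2) :* e) :=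
                 con 1ℤ :* (f :* g) :+ con (ℤ.- + 2) :* (e :* f) :+ con (ℤ.- + 2) :* (e :* g)
                     :+ con (+ 4) :* (e :* e))
                 refl (F k l) (F k l ⋆) (δ k l)) ⟩
          ∑[ l < d ] (int 1ℤ * (F k l * F k l ⋆) + int (ℤ.- + 2) * (δ k l * F k l)
              + int (ℤ.- + 2) * (δ k l * F k l ⋆) + int (+ 4) * (δ k l * δ k l))
            ≈⟨ sum-lin _ _ _ _ (λ l → F k l * F k l ⋆) (λ l → δ k l * F k l) (λ l → δ k l * F k l ⋆)
                 (λ l → δ k l * δ k l) ⟩
          int 1ℤ * R k + int (ℤ.- + 2) * ∑[ l < d ] (δ k l * F k l)
              + int (ℤ.- + 2) * ∑[ l < d ] (δ k l * F k l ⋆) + int (+ 4) * ∑[ l < d ] (δ k l * δ k l)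
            ≈⟨ +-cong (+-cong (+-congˡ (*-congˡ (sum-δ k (F k)))) (*-congˡ (sum-δ k (λ l → F k l ⋆))))
                 (*-congˡ (trans (sum-δ k (δ k)) (δ-refl k))) ⟩
          int 1ℤ * R k + int (ℤ.- + 2) * F k k + int (ℤ.- + 2) * F k k ⋆ + int (+ 4) * int 1ℤ ∎

      -- By `w-eq` every row of w + δᵢⱼ (1 - w) sums to n w + 1 - w = 2.
      ∑D : ∑[ i < n ] ∑[ j < n ] D i j ≈ int (+ 2) * int (+ n) - Φ
      ∑D = begin
        ∑[ i < n ] ∑[ j < n ] D i j
          ≈⟨ sum-cong n row ⟩
        ∑[ i < n ] (int (+ 2) * int 1ℤ + int -1ℤ * R i + int 0ℤ * R i + int 0ℤ * R i)
          ≈⟨ sum-lin _ _ _ _ (λ _ → int 1ℤ) R R R ⟩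
        int (+ 2) * ∑[ i < n ] int 1ℤ + int -1ℤ * Φ + int 0ℤ * Φ + int 0ℤ * Φ
          ≈⟨ +-congʳ (+-congʳ (+-congʳ (*-congˡ (sum-const n _)))) ⟩
        int (+ 2) * (int (+ n) * int 1ℤ) + int -1ℤ * Φ + int 0ℤ * Φ + int 0ℤ * Φ
          ≈⟨ solve 2 (λ n f → con (+ 2) :* (n :* con 1ℤ) :+ con -1ℤ :* f :+ con 0ℤ :* f
               :+ con 0ℤ :* f := con (+ 2) :* n :- f) refl _ Φ ⟩
        int (+ 2) * int (+ n) - Φ ∎
        where
        R : Fin n → Carrier
        R i = ∑[ j < n ] (G i j * G i j ⋆)
        row : ∀ i → ∑[ j < n ] D i j ≈ int (+ 2) * int 1ℤ + int -1ℤ * R i + int 0ℤ * R i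
            + int 0ℤ * R i
        row i = begin
          ∑[ j < n ] D i j
            ≈⟨ sum-cong n (λ j → solve 3 (λ w e g → w :+ e :* (con 1ℤ :- w) :- g :=
                 con 1ℤ :* w :+ con 1ℤ :* (e :* (con 1ℤ :- w)) :+ con -1ℤ :* g :+ con 0ℤ :* g) refl
                     w (δ i j) (G i j * G i j ⋆)) ⟩
          ∑[ j < n ] (int 1ℤ * w + int 1ℤ * (δ i j * (int 1ℤ - w)) + int -1ℤ * (G i j * G i j ⋆)
              + int 0ℤ * (G i j * G i j ⋆))
            ≈⟨ sum-lin _ _ _ _ (λ _ → w) (λ j → δ i j * (int 1ℤ - w)) (λ j → G i j * G i j ⋆)
                 (λ j → G i j * G i j ⋆) ⟩
          int 1ℤ * ∑[ j < n ] w + int 1ℤ * ∑[ j < n ] (δ i j * (int 1ℤ - w)) + int -1ℤ * R i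
              + int 0ℤ * R i
            ≈⟨ +-congʳ (+-congʳ (+-cong (*-congˡ (trans (sum-const n w) w-eq))
                 (*-congˡ (sum-δ i (λ _ → int 1ℤ - w))))) ⟩
          int 1ℤ * (int 1ℤ + w) + int 1ℤ * (int 1ℤ - w) + int -1ℤ * R i + int 0ℤ * R i
            ≈⟨ solve 2 (λ w r → con 1ℤ :* (con 1ℤ :+ w) :+ con 1ℤ :* (con 1ℤ :- w) :+ con -1ℤ :* r
                 :+ con 0ℤ :* r :=
                 con (+ 2) :* con 1ℤ :+ con -1ℤ :* r :+ con 0ℤ :* r :+ con 0ℤ :* r) refl w (R i) ⟩
          int (+ 2) * int 1ℤ + int -1ℤ * R i + int 0ℤ * R i + int 0ℤ * R i ∎

      -- The frame potential Φ cancels and 4d - 2n remains, which is where the redundancy n = 2d is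
      -- spent.
      total : ∑[ k < d ] ∑[ l < d ] (E k l * E k l ⋆) + ∑[ i < n ] ∑[ j < n ] D i j ≈ 0#
      total = begin
        ∑[ k < d ] ∑[ l < d ] (E k l * E k l ⋆) + ∑[ i < n ] ∑[ j < n ] D i j
          ≈⟨ +-cong ∑E ∑D ⟩
        Φ - int (+ 4) * int (+ n) + int (+ 4) * int (+ d) + (int (+ 2) * int (+ n) - Φ)
          ≈⟨ solve 3 (λ f n d → f :- con (+ 4) :* n :+ con (+ 4) :* d :+ (con (+ 2) :* n :- f) :=
               con (ℤ.- + 2) :* n :+ con (+ 4) :* d) refl Φ _ _ ⟩
        int (ℤ.- + 2) * int (+ n) + int (+ 4) * int (+ d)
          ≈⟨ +-congʳ (*-congˡ (trans (reflexive
               (≡.cong int (≡.trans (≡.cong +_ n≡2d) (ℤ.pos-* 2 d)))) (int-* (+ 2) (+ d)))) ⟩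
        int (ℤ.- + 2) * (int (+ 2) * int (+ d)) + int (+ 4) * int (+ d)
          ≈⟨ solve 1 (λ d → con (ℤ.- + 2) :* (con (+ 2) :* d) :+ con (+ 4) :* d := con 0ℤ) refl _ ⟩
        int 0ℤ
          ≈⟨ int-0 ⟩
        0# ∎

      D-nonNeg : ∀ i j → NonNeg (D i j)
      D-nonNeg i j with i Fin.≟ j
      ... | no i≢j = nonNeg-resp (+-congʳ (solve 1 (λ w → w := w :+ con 0ℤ :* (con 1ℤ :- w)) refl w))
          (bound i≢j)
      ... | yes ≡.refl = nonNeg-resp (sym (begin
        w + int 1ℤ * (int 1ℤ - w) - G i i * G i i ⋆
          ≈⟨ +-congˡ (-‿cong (*-cong (unit i) (trans (⋆-cong (unit i)) (int-⋆ _)))) ⟩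
        w + int 1ℤ * (int 1ℤ - w) - int 1ℤ * int 1ℤ
          ≈⟨ solve 1 (λ w → w :+ con 1ℤ :* (con 1ℤ :- w) :- con 1ℤ :* con 1ℤ := con 0ℤ) refl w ⟩
        int 0ℤ ≈⟨ int-0 ⟩
        0# ∎)) nonNeg-0

      E-nonNeg : ∀ k l → NonNeg (E k l * E k l ⋆)
      E-nonNeg k l = nonNeg-⋆ (E k l)

      ∑D-nonNeg = nonNeg-sum _ (λ i → nonNeg-sum (D i) (D-nonNeg i))
      ∑E-nonNeg = nonNeg-sum _ (λ k → nonNeg-sum _ (E-nonNeg k))

      D≈0 : ∀ i j → D i j ≈ 0#
      D≈0 = vanish-sum₂ D D-nonNeg (vanish ∑D-nonNeg ∑E-nonNeg (trans (+-comm _ _) total))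

      E≈0 : ∀ k l → E k l ≈ 0#
      E≈0 k l = definite _ (vanish-sum₂ _ E-nonNeg (vanish ∑E-nonNeg ∑D-nonNeg total) k l)

      tight : ∀ k l → F k l ≈ int (+ 2) * δ k l
      tight k l = begin
        F k l
            ≈⟨ solve 2 (λ f g → f := f :- g :+ g) refl _ (int (+ 2) * δ k l) ⟩
        F k l - int (+ 2) * δ k l + int (+ 2) * δ k l         ≈⟨ +-congʳ (E≈0 k l) ⟩
        0# + int (+ 2) * δ k l                                ≈⟨ +-identityˡ _ ⟩
        int (+ 2) * δ k l                                     ∎

    equiangular : ∀ {i j} → i ≢ j → gram x i j * gram x i j ⋆ ≈ w
    equiangular {i} {j} i≢j = begin
      G i j * G i j ⋆
        ≈⟨ solve 3 (λ w e g → g := (w :+ e :* (con 1ℤ :- w)) :- (w :+ e :* (con 1ℤ :- w) :- g)) refl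
             w (δ i j) _ ⟩
      w + δ i j * (int 1ℤ - w) - D i j
        ≈⟨ +-cong (+-congˡ (*-congʳ (δ-≢ i≢j))) (-‿cong (trans (D≈0 i j) (sym int-0))) ⟩
      w + int 0ℤ * (int 1ℤ - w) - int 0ℤ
        ≈⟨ solve 1 (λ w → w :+ con 0ℤ :* (con 1ℤ :- w) :- con 0ℤ := w) refl w ⟩
      w ∎

    -- G² = X (X*X) X*, and `tight` replaces the middle factor, the frame operator, by 2I.
    gram-idem : ∀ i l → ∑[ j < n ] (gram x i j * gram x j l) ≈ int (+ 2) * gram x i l
    gram-idem i l = begin
      ∑[ j < n ] (G i j * G j l)
        ≈⟨ sum-cong n (λ j → sum-product (λ k → x i k * x j k ⋆) (λ m → x j m * x l m ⋆)) ⟩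
      ∑[ j < n ] ∑[ k < d ] ∑[ m < d ] (x i k * x j k ⋆ * (x j m * x l m ⋆))
        ≈⟨ ∑-comm {n} {d} (λ j k → ∑[ m < d ] (x i k * x j k ⋆ * (x j m * x l m ⋆))) ⟩
      ∑[ k < d ] ∑[ j < n ] ∑[ m < d ] (x i k * x j k ⋆ * (x j m * x l m ⋆))
        ≈⟨ sum-cong d (λ k → ∑-comm {n} {d} (λ j m → x i k * x j k ⋆ * (x j m * x l m ⋆))) ⟩
      ∑[ k < d ] ∑[ m < d ] ∑[ j < n ] (x i k * x j k ⋆ * (x j m * x l m ⋆))
        ≈⟨ sum-cong d (λ k → trans (sum-cong d (λ m → trans
             (sum-cong n (λ j → solve 4 (λ a b c e → a :* b :* (c :* e) := a :* e :* (b :* c)) refl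
                (x i k) (x j k ⋆) (x j m) (x l m ⋆)))
             (trans (sym (*-distribˡ-sum {n} (x i k * x l m ⋆) (λ j → x j k ⋆ * x j m)))
               (trans (*-congˡ (tight k m))
                 (solve 3 (λ a b e → a :* b :* (con (+ 2) :* e) := e :* (con (+ 2) :* (a :* b))) refl
                   (x i k) (x l m ⋆) (δ k m))))))
             (sum-δ k (λ m → int (+ 2) * (x i k * x l m ⋆)))) ⟩
      ∑[ k < d ] (int (+ 2) * (x i k * x l k ⋆))
        ≈⟨ *-distribˡ-sum {d} _ (λ k → x i k * x l k ⋆) ⟨
      int (+ 2) * G i l ∎

  -- Kronecker indices and the new signature matrix

  sum-++ : ∀ m {n} (f : Vector Carrier (m ℕ.+ n)) →
    sum f ≈ ∑[ i < m ] f (i ↑ˡ n) + ∑[ j < n ] f (m ↑ʳ j)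
  sum-++ zero    f = sym (+-identityˡ _)
  sum-++ (suc m) f = trans (+-congˡ (sum-++ m (f ∘ suc))) (sym (+-assoc _ _ _))

  sum-remQuot : ∀ m n (f : Fin m × Fin n → Carrier) →
    ∑[ p < m ℕ.* n ] f (remQuot n p) ≈ ∑[ i < m ] ∑[ j < n ] f (i , j)
  sum-remQuot zero    n f = refl
  sum-remQuot (suc m) n f = begin
    ∑[ p < n ℕ.+ m ℕ.* n ] f (remQuot n p)
      ≈⟨ sum-++ n {m ℕ.* n} (λ p → f (remQuot n p)) ⟩
    ∑[ j < n ] f (remQuot n (j ↑ˡ m ℕ.* n)) + ∑[ p < m ℕ.* n ] f (remQuot n (n ↑ʳ p))
      ≈⟨ +-cong
           (sum-cong n (λ j → reflexive (≡.cong f (Fin.remQuot-combine {suc m} zero j))))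
           (sum-cong (m ℕ.* n) (λ p → reflexive (≡.cong f (remQuot-↑ʳ p)))) ⟩
    ∑[ j < n ] f (zero , j) + ∑[ p < m ℕ.* n ] f (map₁ suc (remQuot n p))
      ≈⟨ +-congˡ (sum-remQuot m n (f ∘ map₁ suc)) ⟩
    ∑[ j < n ] f (zero , j) + ∑[ i < m ] ∑[ j < n ] f (suc i , j) ∎
    where
    remQuot-↑ʳ : ∀ p → remQuot {suc m} n (n ↑ʳ p) ≡ map₁ suc (remQuot n p)
    remQuot-↑ʳ p rewrite Fin.splitAt-↑ʳ n (m ℕ.* n) p = ≡.refl

  remQuot-injective : ∀ {m n} (p q : Fin (m ℕ.* n)) → remQuot {m} n p ≡ remQuot {m} n q → p ≡ q
  remQuot-injective {m} {n} p q eq = ≡.trans (≡.sym (Fin.combine-remQuot {m} n p))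
    (≡.trans (≡.cong (uncurry combine) eq) (Fin.combine-remQuot {m} n q))

  -- The equations for w and w′ say w = 1/(n − 1) and w′ = 1/(nm − 1).
  module Signature {n m} (G : Fin n → Fin n → Carrier) (a c : Fin m → Fin m → Carrier)
    (w w′ α γ : Carrier)
    (w-eq : int (+ n) * w ≈ int 1ℤ + w)
    (w′-eq : int (+ n) * int (+ m) * w′ ≈ int 1ℤ + w′)
    (α-⋆ : α ⋆ ≈ α) (α² : α * α ≈ (int (+ n) - int 1ℤ) * w′)
    (γ-⋆ : γ ⋆ ≈ - γ) (γ² : γ * γ ≈ - w′)
    (G-⋆ : ∀ i j → G i j ⋆ ≈ G j i)
    (G² : ∀ i l → ∑[ j < n ] (G i j * G j l) ≈ int (+ 2) * G i l)
    (G-diagonal : ∀ i → G i i ≈ int 1ℤ)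
    (G-norm : ∀ {i j} → i ≢ j → G i j * G i j ⋆ ≈ w)
    (a-⋆ : ∀ k l → a k l ⋆ ≈ a l k) (c-⋆ : ∀ k l → c k l ⋆ ≈ - c l k)
    (aa : ∀ k q → ∑[ l < m ] (a k l * a l q) ≈ int (+ m) * δ k q)
    (cc : ∀ k q → ∑[ l < m ] (c k l * c l q) ≈ (int 1ℤ - int (+ m)) * δ k q)
    (ac+ca : ∀ k q → ∑[ l < m ] (a k l * c l q) + ∑[ l < m ] (c k l * a l q) ≈ int 0ℤ)
    (a-norm : ∀ k l → a k l * a k l ⋆ ≈ int 1ℤ)
    (c-diagonal : ∀ k → c k k ≈ int 0ℤ)
    (c-norm : ∀ {k l} → k ≢ l → c k l * c k l ⋆ ≈ int 1ℤ) where

    private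
      h : Fin n → Fin n → Carrier
      h i j = G i j - δ i j

      h² : ∀ i l → ∑[ j < n ] (h i j * h j l) ≈ δ i l
      h² i l = begin
        ∑[ j < n ] (h i j * h j l)
          ≈⟨ sum-cong n (λ j → solve 4 (λ g g′ e e′ → (g :- e) :* (g′ :- e′) :=
               con 1ℤ :* (g :* g′) :+ con -1ℤ :* (e :* g′) :+ con -1ℤ :* (g :* e′)
                   :+ con 1ℤ :* (e :* e′))
               refl (G i j) (G j l) (δ i j) (δ j l)) ⟩
        ∑[ j < n ] (int 1ℤ * (G i j * G j l) + int -1ℤ * (δ i j * G j l) + int -1ℤ * (G i j * δ j l)
            + int 1ℤ * (δ i j * δ j l))
          ≈⟨ sum-lin _ _ _ _ (λ j → G i j * G j l) (λ j → δ i j * G j l) (λ j → G i j * δ j l)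
               (λ j → δ i j * δ j l) ⟩
        int 1ℤ * ∑[ j < n ] (G i j * G j l) + int -1ℤ * ∑[ j < n ] (δ i j * G j l)
          + int -1ℤ * ∑[ j < n ] (G i j * δ j l) + int 1ℤ * ∑[ j < n ] (δ i j * δ j l)
          ≈⟨ +-cong (+-cong (+-cong (*-congˡ (G² i l)) (*-congˡ (sum-δ i (λ j → G j l))))
               (*-congˡ (sum-δʳ l (G i)))) (*-congˡ (sum-δ i (λ j → δ j l))) ⟩
        int 1ℤ * (int (+ 2) * G i l) + int -1ℤ * G i l + int -1ℤ * G i l + int 1ℤ * δ i l
          ≈⟨ solve 2 (λ g e → con 1ℤ :* (con (+ 2) :* g) :+ con -1ℤ :* g :+ con -1ℤ :* g
               :+ con 1ℤ :* e := e) refl (G i l) (δ i l) ⟩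
        δ i l ∎

      h-⋆ : ∀ i j → h i j ⋆ ≈ h j i
      h-⋆ i j = trans (⋆-+ _ _) (+-cong (G-⋆ i j)
          (trans (neg-⋆ _) (-‿cong (trans (int-⋆ _) (δ-sym i j)))))

      h-diagonal : ∀ i → h i i ≈ int 0ℤ
      h-diagonal i = trans (+-cong (G-diagonal i) (-‿cong (δ-refl i)))
          (solve 0 (con 1ℤ :- con 1ℤ := con 0ℤ) refl)

      h-norm : ∀ {i j} → i ≢ j → h i j * h i j ⋆ ≈ w
      h-norm {i} {j} i≢j = trans (*-cong h≈G (⋆-cong h≈G)) (G-norm i≢j)
        where
        h≈G : h i j ≈ G i j
        h≈G = trans (+-congˡ (-‿cong (δ-≢ i≢j))) (solve 1 (λ g → g :- con 0ℤ := g) refl _)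

      -- Kept on pairs, where the two tensor factors can be summed one after the other; `T` carries
      -- it over to `Fin (n ℕ.* m)` by `remQuot`.
      S : Fin n × Fin m → Fin n × Fin m → Carrier
      S (i , k) (j , l) = α * (h i j * a k l) + γ * (δ i j * c k l)

      S-⋆ : ∀ p q → S p q ⋆ ≈ S q p
      S-⋆ (i , k) (j , l) = begin
        (α * (h i j * a k l) + γ * (δ i j * c k l)) ⋆
          ≈⟨ trans (⋆-+ _ _) (+-cong (trans (⋆-* _ _) (*-congˡ (⋆-* _ _)))
               (trans (⋆-* _ _) (*-congˡ (⋆-* _ _)))) ⟩
        α ⋆ * (h i j ⋆ * a k l ⋆) + γ ⋆ * (δ i j ⋆ * c k l ⋆)
          ≈⟨ +-cong (*-cong α-⋆ (*-cong (h-⋆ i j) (a-⋆ k l)))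
               (*-cong γ-⋆ (*-cong (trans (int-⋆ _) (δ-sym i j)) (c-⋆ k l))) ⟩
        α * (h j i * a l k) + - γ * (δ j i * - c l k)
          ≈⟨ +-congˡ (solve 3 (λ g e c → :- g :* (e :* (:- c)) := g :* (e :* c)) refl γ (δ j i)
               (c l k)) ⟩
        S (j , l) (i , k) ∎

      S-diagonal : ∀ p → S p p ≈ int 0ℤ
      S-diagonal (i , k) = begin
        α * (h i i * a k k) + γ * (δ i i * c k k)
          ≈⟨ +-cong (*-congˡ (*-congʳ (h-diagonal i))) (*-congˡ (*-congˡ (c-diagonal k))) ⟩
        α * (int 0ℤ * a k k) + γ * (δ i i * int 0ℤ)
          ≈⟨ solve 4 (λ x a g e → x :* (con 0ℤ :* a) :+ g :* (e :* con 0ℤ) := con 0ℤ) refl α (a k k)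
               γ (δ i i) ⟩
        int 0ℤ ∎

      S-norm : ∀ p q → p ≢ q → S p q * S p q ⋆ ≈ w′
      S-norm (i , k) (j , l) p≢q with i Fin.≟ j
      ... | no i≢j = begin
        s * s ⋆
          ≈⟨ *-cong s≈ (trans (⋆-cong s≈) (trans (⋆-* _ _) (*-cong α-⋆ (⋆-* _ _)))) ⟩
        α * (h i j * a k l) * (α * (h i j ⋆ * a k l ⋆))
          ≈⟨ solve 5 (λ x h a h⋆ a⋆ → x :* (h :* a) :* (x :* (h⋆ :* a⋆))
               := x :* x :* (h :* h⋆) :* (a :* a⋆))
               refl α (h i j) (a k l) (h i j ⋆) (a k l ⋆) ⟩
        α * α * (h i j * h i j ⋆) * (a k l * a k l ⋆)
          ≈⟨ *-cong (*-cong α² (h-norm i≢j)) (a-norm k l) ⟩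
        (int (+ n) - int 1ℤ) * w′ * w * int 1ℤ
          ≈⟨ solve 3 (λ n w′ w → (n :- con 1ℤ) :* w′ :* w :* con 1ℤ := w′ :* (n :* w :- w)) refl _
               w′ w ⟩
        w′ * (int (+ n) * w - w)
          ≈⟨ *-congˡ (+-congʳ w-eq) ⟩
        w′ * (int 1ℤ + w - w)
          ≈⟨ solve 2 (λ w′ w → w′ :* (con 1ℤ :+ w :- w) := w′) refl w′ w ⟩
        w′ ∎
        where
        -- The `with` has replaced `δ i j` by `int 0ℤ`, also inside `h i j`, so the entry of `S` is
        -- restated in that form and then led back to `h i j`.
        s : Carrier
        s = α * (h′ * a k l) + γ * (int 0ℤ * c k l)
          where h′ = G i j - int 0ℤ
        s≈ : s ≈ α * (h i j * a k l)
        s≈ = trans (+-congʳ (*-congˡ (*-congʳ (+-congˡ (-‿cong (sym (δ-≢ i≢j)))))))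
               (solve 3 (λ x g c → x :+ g :* (con 0ℤ :* c) := x) refl (α * (h i j * a k l)) γ (c k l))
      ... | yes ≡.refl = begin
        s * s ⋆
          ≈⟨ *-cong s≈ (trans (⋆-cong s≈) (⋆-* _ _)) ⟩
        γ * c k l * (γ ⋆ * c k l ⋆)
          ≈⟨ *-congˡ (*-congʳ γ-⋆) ⟩
        γ * c k l * (- γ * c k l ⋆)
          ≈⟨ solve 3 (λ g c c⋆ → g :* c :* (:- g :* c⋆) := :- (g :* g) :* (c :* c⋆)) refl γ (c k l)
               (c k l ⋆) ⟩
        - (γ * γ) * (c k l * c k l ⋆)
          -- Within a diagonal block, distinct pairs differ in the second component.
          ≈⟨ *-cong (-‿cong γ²) (c-norm (λ { ≡.refl → p≢q ≡.refl })) ⟩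
        - (- w′) * int 1ℤ
          ≈⟨ solve 1 (λ w → :- (:- w) :* con 1ℤ := w) refl w′ ⟩
        w′ ∎
        where
        s : Carrier
        s = α * ((G i i - int 1ℤ) * a k l) + γ * (int 1ℤ * c k l)
        s≈ : s ≈ γ * c k l
        s≈ = trans (+-congʳ (*-congˡ (*-congʳ (+-congʳ (G-diagonal i)))))
               (solve 4 (λ x a g c → x :* ((con 1ℤ :- con 1ℤ) :* a) :+ g :* (con 1ℤ :* c)
                   := g :* c) refl α (a k l) γ (c k l))

      -- Squaring gives four Kronecker terms. The two mixed ones share the factor `h i i′`, since I
      -- stands next to h in both, and add up to a multiple of AC + CA = 0. The two squares
      -- contribute (n - 1) w′ m and -w′ (1 - m), with sum w′ (nm - 1) = 1.
      S² : ∀ p q → ∑[ j < n ] ∑[ l < m ] (S p (j , l) * S (j , l) q) ≈ δ (proj₁ p)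
          (proj₁ q) * δ (proj₂ p) (proj₂ q)
      S² (i , k) (i′ , k′) = begin
        ∑[ j < n ] ∑[ l < m ] (S (i , k) (j , l) * S (j , l) (i′ , k′))
          ≈⟨ sum-cong n row ⟩
        ∑[ j < n ] (α * α * AA * (h i j * h j i′) + α * γ * AC * (h i j * δ j i′)
            + γ * α * CA * (δ i j * h j i′) + γ * γ * CC * (δ i j * δ j i′))
          ≈⟨ sum-lin _ _ _ _ (λ j → h i j * h j i′) (λ j → h i j * δ j i′) (λ j → δ i j * h j i′)
               (λ j → δ i j * δ j i′) ⟩
        α * α * AA * ∑[ j < n ] (h i j * h j i′) + α * γ * AC * ∑[ j < n ] (h i j * δ j i′)
            + γ * α * CA * ∑[ j < n ] (δ i j * h j i′) + γ * γ * CC * ∑[ j < n ] (δ i j * δ j i′)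
          ≈⟨ +-cong (+-cong (+-cong (*-cong (*-cong α² (aa k k′)) (h² i i′))
               (*-congˡ (sum-δʳ i′ (h i))))
               (*-congˡ (sum-δ i (λ j → h j i′))))
                   (*-cong (*-cong γ² (cc k k′)) (sum-δ i (λ j → δ j i′))) ⟩
        (ν - int 1ℤ) * w′ * (μ * δ k k′) * δ i i′ + α * γ * AC * h i i′ + γ * α * CA * h i i′
            + - w′ * ((int 1ℤ - μ) * δ k k′) * δ i i′
          ≈⟨ solve 10 (λ n m w e f x g p q h →
               (n :- con 1ℤ) :* w :* (m :* f) :* e :+ x :* g :* p :* h :+ g :* x :* q :* h
                 :+ :- w :* ((con 1ℤ :- m) :* f) :* e :=
               (n :* m :* w :- w) :* (e :* f) :+ x :* g :* h :* (p :+ q)) refl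
               ν μ w′ (δ i i′) (δ k k′) α γ AC CA (h i i′) ⟩
        (ν * μ * w′ - w′) * (δ i i′ * δ k k′) + α * γ * h i i′ * (AC + CA)
          ≈⟨ +-cong (*-congʳ (+-congʳ w′-eq)) (*-congˡ (ac+ca k k′)) ⟩
        (int 1ℤ + w′ - w′) * (δ i i′ * δ k k′) + α * γ * h i i′ * int 0ℤ
          ≈⟨ solve 3 (λ w e z → (con 1ℤ :+ w :- w) :* e :+ z :* con 0ℤ
               := e) refl w′ (δ i i′ * δ k k′) (α * γ * h i i′) ⟩
        δ i i′ * δ k k′ ∎
        where
        ν μ AA AC CA CC : Carrier
        ν = int (+ n)
        μ = int (+ m)
        AA = ∑[ l < m ] (a k l * a l k′)
        AC = ∑[ l < m ] (a k l * c l k′)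
        CA = ∑[ l < m ] (c k l * a l k′)
        CC = ∑[ l < m ] (c k l * c l k′)
        row : ∀ j → ∑[ l < m ] (S (i , k) (j , l) * S (j , l) (i′ , k′)) ≈
          α * α * AA * (h i j * h j i′) + α * γ * AC * (h i j * δ j i′)
            + γ * α * CA * (δ i j * h j i′) + γ * γ * CC * (δ i j * δ j i′)
        row j = begin
          ∑[ l < m ] (S (i , k) (j , l) * S (j , l) (i′ , k′))
            ≈⟨ sum-cong m (λ l → solve 10 (λ x g h h′ e e′ a a′ c c′ →
                 (x :* (h :* a) :+ g :* (e :* c)) :* (x :* (h′ :* a′) :+ g :* (e′ :* c′)) :=
                 x :* x :* (h :* h′) :* (a :* a′) :+ x :* g :* (h :* e′) :* (a :* c′)
                   :+ g :* x :* (e :* h′) :* (c :* a′) :+ g :* g :* (e :* e′) :* (c :* c′)) refl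
                 α γ (h i j) (h j i′) (δ i j) (δ j i′) (a k l) (a l k′) (c k l) (c l k′)) ⟩
          ∑[ l < m ] (α * α * (h i j * h j i′) * (a k l * a l k′)
              + α * γ * (h i j * δ j i′) * (a k l * c l k′)
              + γ * α * (δ i j * h j i′) * (c k l * a l k′)
                  + γ * γ * (δ i j * δ j i′) * (c k l * c l k′))
            ≈⟨ sum-lin _ _ _ _ (λ l → a k l * a l k′) (λ l → a k l * c l k′) (λ l → c k l * a l k′)
                 (λ l → c k l * c l k′) ⟩
          α * α * (h i j * h j i′) * AA + α * γ * (h i j * δ j i′) * AC
            + γ * α * (δ i j * h j i′) * CA + γ * γ * (δ i j * δ j i′) * CC
            ≈⟨ +-cong (+-cong (+-cong (swap _ _ _) (swap _ _ _)) (swap _ _ _)) (swap _ _ _) ⟩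
          α * α * AA * (h i j * h j i′) + α * γ * AC * (h i j * δ j i′)
            + γ * α * CA * (δ i j * h j i′) + γ * γ * CC * (δ i j * δ j i′) ∎
          where
          swap : ∀ x y z → x * y * z ≈ x * z * y
          swap = solve 3 (λ x y z → x :* y :* z := x :* z :* y) refl

      δ-remQuot : ∀ p q → let i , k = remQuot {n} m p; j , l = remQuot {n} m q in δ i j * δ k l ≈ δ p q
      δ-remQuot p q with p Fin.≟ q
      ... | yes ≡.refl = trans (*-cong (δ-refl (proj₁ (remQuot {n} m p)))
          (δ-refl (proj₂ (remQuot {n} m p)))) (solve 0 (con 1ℤ :* con 1ℤ := con 1ℤ) refl)
      ... | no p≢q with proj₁ (remQuot {n} m p) Fin.≟ proj₁ (remQuot {n} m q)
      ...   | no _ = solve 1 (λ x → con 0ℤ :* x := con 0ℤ) refl _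
      ...   | yes i≡j = trans (*-congˡ (δ-≢
          (λ k≡l → p≢q (remQuot-injective p q (≡.cong₂ _,_ i≡j k≡l)))))
          (solve 1 (λ x → x :* con 0ℤ := con 0ℤ) refl _)

      T : Fin (n ℕ.* m) → Fin (n ℕ.* m) → Carrier
      T p q = S (remQuot m p) (remQuot m q)

      T² : ∀ p q → ∑[ r < n ℕ.* m ] (T p r * T r q) ≈ δ p q
      T² p q = begin
        ∑[ r < n ℕ.* m ] (T p r * T r q)
          ≈⟨ sum-remQuot n m (λ r → S (remQuot m p) r * S r (remQuot m q)) ⟩
        ∑[ j < n ] ∑[ l < m ] (S (remQuot m p) (j , l) * S (j , l) (remQuot m q))
          ≈⟨ S² (remQuot m p) (remQuot m q) ⟩
        _
          ≈⟨ δ-remQuot p q ⟩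
        δ p q ∎

    M : Fin (n ℕ.* m) → Fin (n ℕ.* m) → Carrier
    M p q = δ p q + T p q

    M-⋆ : ∀ p q → M p q ⋆ ≈ M q p
    M-⋆ p q = trans (⋆-+ _ _) (+-cong (trans (int-⋆ _) (δ-sym p q)) (S-⋆ _ _))

    M-diagonal : ∀ p → M p p ≈ int 1ℤ
    M-diagonal p = trans (+-cong (δ-refl p) (S-diagonal _))
        (solve 0 (con 1ℤ :+ con 0ℤ := con 1ℤ) refl)

    M-norm : ∀ {p q} → p ≢ q → M p q * M p q ⋆ ≈ w′
    M-norm {p} {q} p≢q = trans (*-cong M≈T (⋆-cong M≈T)) (S-norm _ _ (p≢q ∘ remQuot-injective p q))
      where
      M≈T : M p q ≈ T p q
      M≈T = trans (+-congʳ (δ-≢ p≢q)) (solve 1 (λ t → con 0ℤ :+ t := t) refl _)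

    M² : ∀ p q → ∑[ r < n ℕ.* m ] (M p r * M r q) ≈ int (+ 2) * M p q
    M² p q = begin
      ∑[ r < n ℕ.* m ] (M p r * M r q)
        ≈⟨ sum-cong (n ℕ.* m) (λ r → solve 4 (λ e e′ t t′ → (e :+ t) :* (e′ :+ t′) :=
             con 1ℤ :* (e :* e′) :+ con 1ℤ :* (e :* t′) :+ con 1ℤ :* (t :* e′) :+ con 1ℤ :* (t :* t′))
             refl (δ p r) (δ r q) (T p r) (T r q)) ⟩
      ∑[ r < n ℕ.* m ] (int 1ℤ * (δ p r * δ r q) + int 1ℤ * (δ p r * T r q)
          + int 1ℤ * (T p r * δ r q) + int 1ℤ * (T p r * T r q))
        ≈⟨ sum-lin _ _ _ _ (λ r → δ p r * δ r q) (λ r → δ p r * T r q) (λ r → T p r * δ r q)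
             (λ r → T p r * T r q) ⟩
      int 1ℤ * ∑[ r < n ℕ.* m ] (δ p r * δ r q) + int 1ℤ * ∑[ r < n ℕ.* m ] (δ p r * T r q)
        + int 1ℤ * ∑[ r < n ℕ.* m ] (T p r * δ r q) + int 1ℤ * ∑[ r < n ℕ.* m ] (T p r * T r q)
        ≈⟨ +-cong (+-cong (+-cong (*-congˡ (sum-δ p (λ r → δ r q))) (*-congˡ (sum-δ p (λ r → T r q))))
             (*-congˡ (sum-δʳ q (T p)))) (*-congˡ (T² p q)) ⟩
      int 1ℤ * δ p q + int 1ℤ * T p q + int 1ℤ * T p q + int 1ℤ * δ p q
        ≈⟨ solve 2 (λ e t → con 1ℤ :* e :+ con 1ℤ :* t :+ con 1ℤ :* t :+ con 1ℤ :* e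
             := con (+ 2) :* (e :+ t)) refl (δ p q) (T p q) ⟩
      int (+ 2) * M p q ∎

    -- Together with `M²` this fixes the rank: a matrix that is twice a projection has twice the
    -- rank as its trace. Half of it is the number of steps that `factor` takes.
    M-trace : ∑[ p < n ℕ.* m ] M p p ≈ int (+ (n ℕ.* m))
    M-trace = begin
      ∑[ p < n ℕ.* m ] M p p            ≈⟨ sum-cong (n ℕ.* m) M-diagonal ⟩
      ∑[ p < n ℕ.* m ] int 1ℤ           ≈⟨ sum-const (n ℕ.* m) _ ⟩
      int (+ (n ℕ.* m)) * int 1ℤ        ≈⟨ trans (*-congˡ int-1) (*-identityʳ _) ⟩
      int (+ (n ℕ.* m))                 ∎

  -- Matrix identities for an amicable pair

  module Amicable {m} {A B : Matrix m} (AB : IsAmicable A B) where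
    open IsAmicable AB

    private
      B-hadamard : IsHadamard B
      B-hadamard = proj₁ B-skew

      C : Matrix m
      C = proj₁ (proj₂ B-skew)

      B≡C+I : ∀ k l → B k l ≡ C k l ℤ.+ 𝕀 k l
      B≡C+I = proj₁ (proj₂ (proj₂ B-skew))

      C-skew : ∀ k l → C l k ≡ ℤ.- C k l
      C-skew = proj₂ (proj₂ (proj₂ B-skew))

      ≡-neg⇒≡0 : ∀ z → z ≡ ℤ.- z → z ≡ 0ℤ
      -- For any other z the two sides have different constructors, so this clause is exhaustive.
      ≡-neg⇒≡0 (+ zero) _ = ≡.refl

      square : ∀ {z} → z ≡ 1ℤ ⊎ z ≡ -1ℤ → int z * int z ⋆ ≈ int 1ℤ
      square (inj₁ ≡.refl) = trans (*-congˡ (int-⋆ _)) (solve 0 (con 1ℤ :* con 1ℤ := con 1ℤ) refl)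
      square (inj₂ ≡.refl) = trans (*-congˡ (int-⋆ _)) (solve 0 (con -1ℤ :* con -1ℤ := con 1ℤ) refl)

      int-orthogonal : ∀ {H : Matrix m} → IsHadamard H → ∀ k q →
          int ((H ⊛ H ᵀ) k q) ≈ int (+ m) * δ k q
      int-orthogonal H-hadamard k q =
        trans (reflexive (≡.cong int (IsHadamard.orthogonal H-hadamard k q))) (int-* (+ m) (𝕀 k q))

      int-⊛ : ∀ (X Y : Matrix m) k q → int ((X ⊛ Y) k q) ≈ ∑[ l < m ] (int (X k l) * int (Y l q))
      int-⊛ X Y k q = trans (sum-int (λ l → X k l ℤ.* Y l q))
          (sum-cong m (λ l → int-* (X k l) (Y l q)))

    a c : Fin m → Fin m → Carrier
    a k l = int (A k l)
    c k l = int (C k l)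

    private
      b≈ : ∀ k l → int (B k l) ≈ c k l + δ k l
      b≈ k l = trans (reflexive (≡.cong int (B≡C+I k l))) (int-+ _ _)

      c-skew : ∀ k l → c k l ≈ - c l k
      c-skew k l = trans (reflexive (≡.cong int (C-skew l k))) (int-neg _)

      -- The transpose of C + I is I - C. This is the form in which B enters as a transposed right
      -- factor.
      bᵀ≈ : ∀ k l → int (B k l) ≈ δ l k - c l k
      bᵀ≈ k l = trans (b≈ k l) (trans (+-cong (c-skew k l) (δ-sym k l)) (+-comm _ _))

    a-⋆ : ∀ k l → a k l ⋆ ≈ a l k
    a-⋆ k l = trans (int-⋆ _) (reflexive (≡.cong int (A-symmetric k l)))

    c-⋆ : ∀ k l → c k l ⋆ ≈ - c l k
    c-⋆ k l = trans (int-⋆ _) (c-skew k l)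

    a-norm : ∀ k l → a k l * a k l ⋆ ≈ int 1ℤ
    a-norm k l = square (IsHadamard.entries A-hadamard k l)

    c-diagonal : ∀ k → c k k ≈ int 0ℤ
    c-diagonal k = reflexive (≡.cong int (≡-neg⇒≡0 _ (C-skew k k)))

    c-norm : ∀ {k l} → k ≢ l → c k l * c k l ⋆ ≈ int 1ℤ
    c-norm {k} {l} k≢l = trans (*-cong c≈b (⋆-cong c≈b)) (square (IsHadamard.entries B-hadamard k l))
      where
      c≈b : c k l ≈ int (B k l)
      c≈b = sym (trans (b≈ k l) (trans (+-congˡ (trans (δ-≢ k≢l) int-0)) (+-identityʳ _)))

    aa : ∀ k q → ∑[ l < m ] (a k l * a l q) ≈ int (+ m) * δ k q
    aa k q = begin
      ∑[ l < m ] (a k l * a l q)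
        ≈⟨ sum-cong m (λ l → *-congˡ (reflexive (≡.cong int (A-symmetric l q)))) ⟩
      ∑[ l < m ] (a k l * a q l)
        ≈⟨ int-⊛ A (A ᵀ) k q ⟨
      int ((A ⊛ A ᵀ) k q)
        ≈⟨ int-orthogonal A-hadamard k q ⟩
      int (+ m) * δ k q ∎

    -- m I = BBᵀ = (C + I)(I - C) = I - C². The chain starts from C² = I - (C - C² + I - C), with
    -- the bracket written as the four terms that `sum-lin` produces for (C + I)(I - C).
    cc : ∀ k q → ∑[ l < m ] (c k l * c l q) ≈ (int 1ℤ - int (+ m)) * δ k q
    cc k q = begin
      CC
        ≈⟨ solve 3 (λ x e c → x := e :- (con 1ℤ :* c :+ con -1ℤ :* x :+ con 1ℤ :* e :+ con -1ℤ :* c))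
             refl CC (δ k q) (c k q) ⟩
      δ k q - (int 1ℤ * c k q + int -1ℤ * CC + int 1ℤ * δ k q + int -1ℤ * c k q)
        ≈⟨ +-congˡ (-‿cong (+-cong (+-cong (+-congʳ (*-congˡ (sum-δʳ q (c k))))
             (*-congˡ (sum-δ k (λ l → δ l q)))) (*-congˡ (sum-δ k (λ l → c l q))))) ⟨
      δ k q - (int 1ℤ * ∑[ l < m ] (c k l * δ l q) + int -1ℤ * CC
          + int 1ℤ * ∑[ l < m ] (δ k l * δ l q) + int -1ℤ * ∑[ l < m ] (δ k l * c l q))
        ≈⟨ +-congˡ (-‿cong (sum-lin _ _ _ _ (λ l → c k l * δ l q) (λ l → c k l * c l q)
             (λ l → δ k l * δ l q) (λ l → δ k l * c l q))) ⟨
      δ k q - ∑[ l < m ] (int 1ℤ * (c k l * δ l q) + int -1ℤ * (c k l * c l q)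
          + int 1ℤ * (δ k l * δ l q) + int -1ℤ * (δ k l * c l q))
        ≈⟨ +-congˡ (-‿cong (sum-cong m (λ l → solve 4 (λ c e e′ c′ → (c :+ e) :* (e′ :- c′) :=
             con 1ℤ :* (c :* e′) :+ con -1ℤ :* (c :* c′) :+ con 1ℤ :* (e :* e′)
                 :+ con -1ℤ :* (e :* c′))
             refl (c k l) (δ k l) (δ l q) (c l q)))) ⟨
      δ k q - ∑[ l < m ] ((c k l + δ k l) * (δ l q - c l q))
        ≈⟨ +-congˡ (-‿cong (sum-cong m (λ l → *-cong (b≈ k l) (bᵀ≈ q l)))) ⟨
      δ k q - ∑[ l < m ] (int (B k l) * int (B q l))
        ≈⟨ +-congˡ (-‿cong (int-⊛ B (B ᵀ) k q)) ⟨
      δ k q - int ((B ⊛ B ᵀ) k q)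
        ≈⟨ +-congˡ (-‿cong (int-orthogonal B-hadamard k q)) ⟩
      δ k q - int (+ m) * δ k q
        ≈⟨ solve 2 (λ e m → e :- m :* e := (con 1ℤ :- m) :* e) refl (δ k q) _ ⟩
      (int 1ℤ - int (+ m)) * δ k q ∎
      where
      CC : Carrier
      CC = ∑[ l < m ] (c k l * c l q)

    -- ABᵀ = A (I - C) = A - AC, while BAᵀ = (C + I) A = CA + A by the symmetry of A. Amicability
    -- equates the two.
    ac+ca : ∀ k q → ∑[ l < m ] (a k l * c l q) + ∑[ l < m ] (c k l * a l q) ≈ int 0ℤ
    ac+ca k q = begin
      AC + CA
        ≈⟨ solve 3 (λ x y a → x :+ y := (con 1ℤ :* y :+ con 1ℤ :* a :+ con 0ℤ :* y :+ con 0ℤ :* y)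
                                      :- (con 1ℤ :* a :+ con -1ℤ :* x :+ con 0ℤ :* x :+ con 0ℤ :* x))
                                          refl AC CA (a k q) ⟩
      (int 1ℤ * CA + int 1ℤ * a k q + int 0ℤ * CA + int 0ℤ * CA)
        - (int 1ℤ * a k q + int -1ℤ * AC + int 0ℤ * AC + int 0ℤ * AC)
        ≈⟨ +-cong (sym BAᵀ) (-‿cong (sym ABᵀ)) ⟩
      int ((B ⊛ A ᵀ) k q) - int ((A ⊛ B ᵀ) k q)
        ≈⟨ +-congˡ (-‿cong (reflexive (≡.cong int (amicable k q)))) ⟩
      int ((B ⊛ A ᵀ) k q) - int ((B ⊛ A ᵀ) k q)
        ≈⟨ solve 1 (λ x → x :- x := con 0ℤ) refl _ ⟩
      int 0ℤ ∎
      where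
      AC CA : Carrier
      AC = ∑[ l < m ] (a k l * c l q)
      CA = ∑[ l < m ] (c k l * a l q)
      ABᵀ : int ((A ⊛ B ᵀ) k q) ≈ int 1ℤ * a k q + int -1ℤ * AC + int 0ℤ * AC + int 0ℤ * AC
      ABᵀ = begin
        int ((A ⊛ B ᵀ) k q)
          ≈⟨ int-⊛ A (B ᵀ) k q ⟩
        ∑[ l < m ] (a k l * int (B q l))
          ≈⟨ sum-cong m (λ l → trans (*-congˡ (bᵀ≈ q l)) (solve 3 (λ a e c → a :* (e :- c) :=
               con 1ℤ :* (a :* e) :+ con -1ℤ :* (a :* c) :+ con 0ℤ :* (a :* c)
                   :+ con 0ℤ :* (a :* c)) refl (a k l) (δ l q) (c l q))) ⟩
        ∑[ l < m ] (int 1ℤ * (a k l * δ l q) + int -1ℤ * (a k l * c l q) + int 0ℤ * (a k l * c l q)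
            + int 0ℤ * (a k l * c l q))
          ≈⟨ sum-lin _ _ _ _ (λ l → a k l * δ l q) (λ l → a k l * c l q) (λ l → a k l * c l q)
               (λ l → a k l * c l q) ⟩
        int 1ℤ * ∑[ l < m ] (a k l * δ l q) + int -1ℤ * AC + int 0ℤ * AC + int 0ℤ * AC
          ≈⟨ +-congʳ (+-congʳ (+-congʳ (*-congˡ (sum-δʳ q (a k))))) ⟩
        int 1ℤ * a k q + int -1ℤ * AC + int 0ℤ * AC + int 0ℤ * AC ∎
      BAᵀ : int ((B ⊛ A ᵀ) k q) ≈ int 1ℤ * CA + int 1ℤ * a k q + int 0ℤ * CA + int 0ℤ * CA
      BAᵀ = begin
        int ((B ⊛ A ᵀ) k q)
          ≈⟨ int-⊛ B (A ᵀ) k q ⟩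
        ∑[ l < m ] (int (B k l) * a q l)
          ≈⟨ sum-cong m (λ l → trans (*-cong (b≈ k l) (reflexive (≡.cong int (A-symmetric q l))))
               (solve 3 (λ c e a → (c :+ e) :* a :=
               con 1ℤ :* (c :* a) :+ con 1ℤ :* (e :* a) :+ con 0ℤ :* (c :* a) :+ con 0ℤ :* (c :* a))
                   refl (c k l) (δ k l) (a l q))) ⟩
        ∑[ l < m ] (int 1ℤ * (c k l * a l q) + int 1ℤ * (δ k l * a l q) + int 0ℤ * (c k l * a l q)
            + int 0ℤ * (c k l * a l q))
          ≈⟨ sum-lin _ _ _ _ (λ l → c k l * a l q) (λ l → δ k l * a l q) (λ l → c k l * a l q)
               (λ l → c k l * a l q) ⟩
        int 1ℤ * CA + int 1ℤ * ∑[ l < m ] (δ k l * a l q) + int 0ℤ * CA + int 0ℤ * CA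
          ≈⟨ +-congʳ (+-congʳ (+-congˡ (*-congˡ (sum-δ k (λ l → a l q))))) ⟩
        int 1ℤ * CA + int 1ℤ * a k q + int 0ℤ * CA + int 0ℤ * CA ∎

  -- Pivoted Cholesky factorisation: M is twice a projection, and subtracting the rank-one part
  -- that comes from a column with nonzero pivot lowers the rank of the projection by one.
  module Deflation {n} (M : Fin n → Fin n → Carrier)
    (herm : ∀ i j → M i j ⋆ ≈ M j i)
    (idem : ∀ i l → ∑[ k < n ] (M i k * M k l) ≈ int (+ 2) * M i l)
    (j : Fin n) (c : Carrier) (c⋆ : c ⋆ ≈ c) (c²Mⱼⱼ : (c * c) * M j j ≈ int 1ℤ) where

    e : Carrier
    e = c * c
    M′ : Fin n → Fin n → Carrier
    M′ i k = M i k - e * (M i j * M j k)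
    e⋆ : e ⋆ ≈ e
    e⋆ = trans (⋆-* c c) (*-cong c⋆ c⋆)
    herm′ : ∀ i k → M′ i k ⋆ ≈ M′ k i
    herm′ i k = begin
      (M i k - e * (M i j * M j k)) ⋆
        ≈⟨ trans (⋆-+ _ _) (+-congˡ (neg-⋆ _)) ⟩
      M i k ⋆ - (e * (M i j * M j k)) ⋆
        ≈⟨ +-cong (herm i k) (-‿cong (trans (⋆-* _ _)
             (*-cong e⋆ (trans (⋆-* _ _) (*-cong (herm i j) (herm j k)))))) ⟩
      M k i - e * (M j i * M k j)
        ≈⟨ +-congˡ (-‿cong (*-congˡ (*-comm _ _))) ⟩
      M k i - e * (M k j * M j i) ∎
    -- By M² = 2M all inner sums become entries of M. In units of 2 e Mᵢⱼ Mⱼₗ the two cross terms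
    -- give -1 each and the quadratic term gives e Mⱼⱼ = 1, which leaves -1: just the rank-one part
    -- that was subtracted.
    idem′ : ∀ i l → ∑[ k < n ] (M′ i k * M′ k l) ≈ int (+ 2) * M′ i l
    idem′ i l = begin
      ∑[ k < n ] (M′ i k * M′ k l)
        ≈⟨ sum-cong n (λ k → solve 7 (λ e a b u v p q →
             (u :- e :* (a :* p)) :* (v :- e :* (q :* b)) :=
             con 1ℤ :* (u :* v) :+ (:- (e :* a)) :* (p :* v) :+ (:- (e :* b)) :* (u :* q)
               :+ e :* e :* (a :* b) :* (p :* q)) refl e (M i j) (M j l) (M i k) (M k l) (M j k)
                   (M k j)) ⟩
      ∑[ k < n ] (int 1ℤ * (M i k * M k l) + (- (e * M i j)) * (M j k * M k l)
        + (- (e * M j l)) * (M i k * M k j) + e * e * (M i j * M j l) * (M j k * M k j))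
        ≈⟨ sum-lin _ _ _ _ (λ k → M i k * M k l) (λ k → M j k * M k l) (λ k → M i k * M k j)
             (λ k → M j k * M k j) ⟩
      int 1ℤ * ∑[ k < n ] (M i k * M k l) + (- (e * M i j)) * ∑[ k < n ] (M j k * M k l)
        + (- (e * M j l)) * ∑[ k < n ] (M i k * M k j)
            + e * e * (M i j * M j l) * ∑[ k < n ] (M j k * M k j)
        ≈⟨ +-cong (+-cong (+-cong (*-congˡ (idem i l)) (*-congˡ (idem j l))) (*-congˡ (idem i j)))
             (*-congˡ (idem j j)) ⟩
      int 1ℤ * (int (+ 2) * M i l) + (- (e * M i j)) * (int (+ 2) * M j l)
        + (- (e * M j l)) * (int (+ 2) * M i j) + e * e * (M i j * M j l) * (int (+ 2) * M j j)
        ≈⟨ solve 5 (λ e a b m t →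
             con 1ℤ :* (con (+ 2) :* m) :+ (:- (e :* a)) :* (con (+ 2) :* b)
               :+ (:- (e :* b)) :* (con (+ 2) :* a) :+ e :* e :* (a :* b) :* (con (+ 2) :* t) :=
             con (+ 2) :* (m :- con (+ 2) :* (e :* (a :* b)) :+ e :* (a :* b) :* (e :* t)))
             refl e (M i j) (M j l) (M i l) (M j j) ⟩
      int (+ 2) * (M i l - int (+ 2) * (e * (M i j * M j l)) + e * (M i j * M j l) * (e * M j j))
        ≈⟨ *-congˡ (+-congˡ (*-congˡ c²Mⱼⱼ)) ⟩
      int (+ 2) * (M i l - int (+ 2) * (e * (M i j * M j l)) + e * (M i j * M j l) * int 1ℤ)
        ≈⟨ *-congˡ (solve 2 (λ m z → m :- con (+ 2) :* z :+ z :* con 1ℤ := m :- z) refl (M i l)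
             (e * (M i j * M j l))) ⟩
      int (+ 2) * M′ i l ∎
    -- The rank-one part has trace e (M²)ⱼⱼ = 2 e Mⱼⱼ = 2.
    trM′ : ∀ r → ∑[ i < n ] M i i ≈ int (+ (2 ℕ.* suc r)) → ∑[ i < n ] M′ i i ≈ int (+ (2 ℕ.* r))
    trM′ r trM = begin
      ∑[ i < n ] (M i i - e * (M i j * M j i))
        ≈⟨ sum-cong n (λ i → solve 3 (λ m e z → m :- e :* z :=
             con 1ℤ :* m :+ (:- e) :* z :+ con 0ℤ :* m :+ con 0ℤ :* m) refl (M i i) e
                 (M i j * M j i)) ⟩
      ∑[ i < n ] (int 1ℤ * M i i + (- e) * (M i j * M j i) + int 0ℤ * M i i + int 0ℤ * M i i)
        ≈⟨ sum-lin _ _ _ _ (λ i → M i i) (λ i → M i j * M j i) (λ i → M i i) (λ i → M i i) ⟩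
      int 1ℤ * ∑[ i < n ] M i i + (- e) * ∑[ i < n ] (M i j * M j i) + int 0ℤ * ∑[ i < n ] M i i
          + int 0ℤ * ∑[ i < n ] M i i
        ≈⟨ solve 3 (λ m e z → con 1ℤ :* m :+ (:- e) :* z :+ con 0ℤ :* m :+ con 0ℤ :* m
             := m :- e :* z) refl _ e _ ⟩
      ∑[ i < n ] M i i - e * ∑[ i < n ] (M i j * M j i)
        ≈⟨ +-cong trM (-‿cong (*-congˡ (trans (sum-cong n (λ i → *-comm _ _)) (idem j j)))) ⟩
      int (+ (2 ℕ.* suc r)) - e * (int (+ 2) * M j j)
        ≈⟨ +-cong (reflexive (≡.cong (int ∘ +_) (ℕ.*-suc 2 r)))
             (-‿cong (solve 2 (λ e m → e :* (con (+ 2) :* m) := con (+ 2) :* (e :* m)) refl e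
             (M j j))) ⟩
      int (+ 2 ℤ.+ + (2 ℕ.* r)) - int (+ 2) * (e * M j j)
        ≈⟨ +-cong (int-+ (+ 2) _) (-‿cong (*-congˡ c²Mⱼⱼ)) ⟩
      int (+ 2) + int (+ (2 ℕ.* r)) - int (+ 2) * int 1ℤ
        ≈⟨ solve 1 (λ m → con (+ 2) :+ m :- con (+ 2) :* con 1ℤ := m) refl _ ⟩
      int (+ (2 ℕ.* r)) ∎

  -- Induction on the rank r, with the size n of the matrix unchanged. For r = 0 the squared
  -- Frobenius norm is tr M² = 2 tr M = 0, so M vanishes and the empty vectors will do.
  factor : ∀ r {n} (M : Fin n → Fin n → Carrier) →
    (∀ i j → M i j ⋆ ≈ M j i) →
    (∀ i l → ∑[ k < n ] (M i k * M k l) ≈ int (+ 2) * M i l) →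
    ∑[ i < n ] M i i ≈ int (+ (2 ℕ.* r)) →
    ∃ λ (V : Fin n → Vector Carrier r) → ∀ i j → ∑[ k < r ] (V i k * V j k ⋆) ≈ M i j
  factor zero {n} M herm idem trM = (λ _ ()) , λ i j → sym (definite _ (M-null i j))
    where
    M-null : ∀ i j → M i j * M i j ⋆ ≈ 0#
    M-null = vanish-sum₂ _ (λ i j → nonNeg-⋆ (M i j)) (begin
      ∑[ i < n ] ∑[ j < n ] (M i j * M i j ⋆)
        ≈⟨ sum-cong n (λ i → trans (sum-cong n (λ j → *-congˡ (herm i j))) (idem i i)) ⟩
      ∑[ i < n ] (int (+ 2) * M i i)
        ≈⟨ *-distribˡ-sum {n} _ _ ⟨
      int (+ 2) * ∑[ i < n ] M i i
        ≈⟨ *-congˡ (trans trM int-0) ⟩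
      int (+ 2) * 0#
        ≈⟨ zeroʳ _ ⟩
      0# ∎)
  factor (suc r) {n} M herm idem trM =
    let j , c , c⋆ , c²Mⱼⱼ = pivot (λ i → M i i) (λ i → herm i i) _ trM
        open Deflation M herm idem j c c⋆ c²Mⱼⱼ
        V , V-gram = factor r M′ herm′ idem′ (trM′ r trM)
    -- Each step adds one coordinate, the pivot column scaled by c. Its contribution c² Mᵢⱼ Mⱼₖ is
    -- what `M′` lacks. The scaling needs a square root of 1/Mⱼⱼ, which is why `pivot` supplies a
    -- root and not just an inverse.
    in (λ i → (c * M i j) ∷ V i) , λ i k → begin
      c * M i j * (c * M k j) ⋆ + ∑[ l < r ] (V i l * V k l ⋆)
        ≈⟨ +-cong (*-congˡ (trans (⋆-* _ _) (*-cong c⋆ (herm k j)))) (V-gram i k) ⟩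
      c * M i j * (c * M j k) + (M i k - c * c * (M i j * M j k))
        ≈⟨ solve 4 (λ c a b m → c :* a :* (c :* b) :+ (m :- c :* c :* (a :* b)) := m) refl c (M i j)
             (M j k) (M i k) ⟩
      M i k ∎

  -- The product construction over the abstract complex numbers

  frame-product : ∀ {d n m r} {A B : Matrix m} (x : Fin n → Vector Carrier d) {w w′ α β} →
    n ≡ 2 ℕ.* d → n ℕ.* m ≡ 2 ℕ.* r → IsAmicable A B →
    int (+ n) * w ≈ int 1ℤ + w → int (+ n) * int (+ m) * w′ ≈ int 1ℤ + w′ →
    α ⋆ ≈ α → α * α ≈ (int (+ n) - int 1ℤ) * w′ → β ⋆ ≈ β → β * β ≈ w′ →
    (∀ i → gram x i i ≈ int 1ℤ) →
    (∀ {i j} → i ≢ j → NonNeg (w - gram x i j * gram x i j ⋆)) →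
    ∃ λ (y : Fin (n ℕ.* m) → Vector Carrier r) →
      (∀ p → gram y p p ≈ int 1ℤ) × (∀ {p q} → p ≢ q → gram y p q * gram y p q ⋆ ≈ w′)
  frame-product {n = n} {m} {r} x {w} {w′} {α} {β} n≡2d nm≡2r AB w-eq w′-eq α-⋆ α² β-⋆ β² unit bound =
    let y , y-gram = factor r S.M S.M-⋆ S.M² (trans S.M-trace (reflexive (≡.cong (int ∘ +_) nm≡2r)))
    in y , (λ p → trans (y-gram p p) (S.M-diagonal p)) ,
       λ {p} {q} p≢q → trans (*-cong (y-gram p q) (⋆-cong (y-gram p q))) (S.M-norm p≢q)
    where
    module W = WelchEquality x w n≡2d w-eq unit bound
    module H = Amicable AB
    -- γ = iβ: an anti-self-conjugate scalar compensates the skewness of C.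
    γ-⋆ : (β * imag) ⋆ ≈ - (β * imag)
    γ-⋆ = trans (⋆-* _ _) (trans (*-cong β-⋆ imag-⋆)
        (solve 2 (λ b i → b :* (:- i) := :- (b :* i)) refl β imag))
    γ² : (β * imag) * (β * imag) ≈ - w′
    γ² = trans (solve 2 (λ b i → b :* i :* (b :* i) := b :* b :* (i :* i)) refl β imag)
      (trans (*-cong β² imag²) (solve 1 (λ w → w :* con -1ℤ := :- w) refl w′))
    module S = Signature {n} {m} (gram x) H.a H.c w w′ α (β * imag) w-eq w′-eq α-⋆ α² γ-⋆ γ²
      (gram-hermitian x) W.gram-idem unit W.equiangular
      H.a-⋆ H.c-⋆ H.aa H.cc H.ac+ca H.a-norm H.c-diagonal H.c-norm

open ≡ using (refl; sym; trans; cong; cong₂; subst)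
open ℚ.+-*-Solver

-- Rational arithmetic

half-pos : ∀ {ε} → 0ℚ ℚ.< ε → 0ℚ ℚ.< ½ ℚ.* ε
half-pos {ε} 0<ε = ℚ.positive⁻¹ (½ ℚ.* ε) {{ℚ.pos*pos⇒pos ½ ε {{ℚ.positive 0<ε}}}}

half+half : ∀ ε → ½ ℚ.* ε ℚ.+ ½ ℚ.* ε ≡ ε
half+half = solve 1 (λ e → con ½ :* e :+ con ½ :* e := e) refl

*-pos : ∀ {p q} → 0ℚ ℚ.< p → 0ℚ ℚ.< q → 0ℚ ℚ.< p ℚ.* q
*-pos {p} {q} 0<p 0<q = ℚ.positive⁻¹ (p ℚ.* q)
    {{ℚ.pos*pos⇒pos p {{ℚ.positive 0<p}} q {{ℚ.positive 0<q}}}}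

*-mono-≤ : ∀ {p q r s} → 0ℚ ℚ.≤ r → 0ℚ ℚ.≤ q → p ℚ.≤ q → r ℚ.≤ s → p ℚ.* r ℚ.≤ q ℚ.* s
*-mono-≤ {p} {q} {r} {s} 0≤r 0≤q p≤q r≤s = ℚ.≤-trans
  (ℚ.*-monoʳ-≤-nonNeg r {{ℚ.nonNegative 0≤r}} p≤q) (ℚ.*-monoˡ-≤-nonNeg q {{ℚ.nonNegative 0≤q}} r≤s)

p≤∣p∣ : ∀ p → p ℚ.≤ ∣ p ∣
p≤∣p∣ p with ℚ.≤-total 0ℚ p
... | inj₁ 0≤p = ℚ.≤-reflexive (sym (ℚ.0≤p⇒∣p∣≡p 0≤p))
... | inj₂ p≤0 = ℚ.≤-trans p≤0 (ℚ.0≤∣p∣ p)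

∣∣<-intro : ∀ {p ε} → p ℚ.< ε → ℚ.- p ℚ.< ε → ∣ p ∣ ℚ.< ε
∣∣<-intro {p} p<ε -p<ε with ℚ.∣p∣≡p∨∣p∣≡-p p
... | inj₁ eq = subst (ℚ._< _) (sym eq) p<ε
... | inj₂ eq = subst (ℚ._< _) (sym eq) -p<ε

∣∣<⇒< : ∀ {p ε} → ∣ p ∣ ℚ.< ε → p ℚ.< ε
∣∣<⇒< {p} = ℚ.≤-<-trans (p≤∣p∣ p)

∣-∣-comm : ∀ p q → ∣ p ℚ.- q ∣ ≡ ∣ q ℚ.- p ∣
∣-∣-comm p q = trans (sym (ℚ.∣-p∣≡∣p∣ (p ℚ.- q)))
  (cong ∣_∣ (solve 2 (λ p q → :- (p :- q) := q :- p) refl p q))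

square-cancel-< : ∀ {p ε} → 0ℚ ℚ.< ε → ∣ p ∣ ℚ.* ∣ p ∣ ℚ.< ε ℚ.* ε → ∣ p ∣ ℚ.< ε
square-cancel-< {p} {ε} 0<ε p²<ε² with ∣ p ∣ ℚ.<? ε
... | yes p<ε = p<ε
... | no  p≮ε = contradiction
  (ℚ.<-≤-trans p²<ε² (*-mono-≤ (ℚ.<⇒≤ 0<ε) (ℚ.0≤∣p∣ p) (ℚ.≮⇒≥ p≮ε) (ℚ.≮⇒≥ p≮ε)))
  (ℚ.<-irrefl refl)

0≤p*p : ∀ p → 0ℚ ℚ.≤ p ℚ.* p
0≤p*p p with ℚ.≤-total 0ℚ p
... | inj₁ 0≤p = ℚ.nonNegative⁻¹ _ {{ℚ.nonNeg*nonNeg⇒nonNeg p {{ℚ.nonNegative 0≤p}} p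
    {{ℚ.nonNegative 0≤p}}}}
... | inj₂ p≤0 = ℚ.nonNegative⁻¹ _ {{ℚ.nonPos*nonPos⇒nonPos p {{ℚ.nonPositive p≤0}} p
    {{ℚ.nonPositive p≤0}}}}

abstract
  reciprocal : ∀ {p} → 0ℚ ℚ.< p → ∃[ q ] 0ℚ ℚ.< q × p ℚ.* q ≡ 1ℚ
  reciprocal {p} 0<p = 1/ p , ℚ.positive⁻¹ _ {{ℚ.1/pos⇒pos p}} , ℚ.*-inverseʳ p
    where
    instance
      p-pos : ℚ.Positive p
      p-pos = ℚ.positive 0<p
      p-nonZero : ℚ.NonZero p
      p-nonZero = ℚ.pos⇒nonZero p

fromℤ : ℤ → ℚ
fromℤ z = z ℚ./ 1

-- Without normalisation z/1 has numerator z on the nose, so the homomorphism laws of `fromℤ` become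
-- integer identities.
fromℤ-toℚᵘ : ∀ z → ℚ.toℚᵘ (fromℤ z) ℚᵘ.≃ ℚᵘ.mkℚᵘ z 0
fromℤ-toℚᵘ z = ℚ.toℚᵘ-fromℚᵘ (ℚᵘ.mkℚᵘ z 0)

fromℤ-+ : ∀ a b → fromℤ (a ℤ.+ b) ≡ fromℤ a ℚ.+ fromℤ b
fromℤ-+ a b = ℚ.toℚᵘ-injective (ℚᵘ.≃-trans (fromℤ-toℚᵘ (a ℤ.+ b))
  (ℚᵘ.≃-trans (ℚᵘ.*≡* (cong₂ ℤ._*_ (sym (cong₂ ℤ._+_ (ℤ.*-identityʳ a) (ℤ.*-identityʳ b))) refl))
  (ℚᵘ.≃-sym (ℚᵘ.≃-trans (ℚ.toℚᵘ-homo-+ (fromℤ a) (fromℤ b))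
      (ℚᵘ.+-cong (fromℤ-toℚᵘ a) (fromℤ-toℚᵘ b))))))

fromℤ-* : ∀ a b → fromℤ (a ℤ.* b) ≡ fromℤ a ℚ.* fromℤ b
fromℤ-* a b = ℚ.toℚᵘ-injective (ℚᵘ.≃-trans (fromℤ-toℚᵘ (a ℤ.* b))
  (ℚᵘ.≃-sym (ℚᵘ.≃-trans (ℚ.toℚᵘ-homo-* (fromℤ a) (fromℤ b))
      (ℚᵘ.*-cong (fromℤ-toℚᵘ a) (fromℤ-toℚᵘ b)))))

fromℤ-neg : ∀ a → fromℤ (ℤ.- a) ≡ ℚ.- fromℤ a
fromℤ-neg a = ℚ.toℚᵘ-injective (ℚᵘ.≃-trans (fromℤ-toℚᵘ (ℤ.- a))
  (ℚᵘ.≃-sym (ℚᵘ.≃-trans (ℚ.toℚᵘ-homo‿- (fromℤ a)) (ℚᵘ.-‿cong (fromℤ-toℚᵘ a)))))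

fromℕ : ℕ → ℚ
fromℕ n = fromℤ (+ n)

fromℕ-suc : ∀ n → fromℕ (suc n) ≡ 1ℚ ℚ.+ fromℕ n
fromℕ-suc n = fromℤ-+ 1ℤ (+ n)

0≤fromℕ : ∀ n → 0ℚ ℚ.≤ fromℕ n
0≤fromℕ n = ℚ.nonNegative⁻¹ (fromℕ n) {{ℚ.normalize-nonNeg n 1}}

0<fromℕ-suc : ∀ n → 0ℚ ℚ.< fromℕ (suc n)
0<fromℕ-suc n = ℚ.positive⁻¹ (fromℕ (suc n)) {{ℚ.normalize-pos (suc n) 1}}

fromℕ-mono : ∀ {m n} → m ℕ.≤ n → fromℕ m ℚ.≤ fromℕ n
fromℕ-mono {m} {n} m≤n = subst (fromℕ m ℚ.≤_)
    (trans (sym (fromℤ-+ (+ m) (+ (n ℕ.∸ m)))) (cong fromℕ (ℕ.m+[n∸m]≡n m≤n)))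
  (subst (ℚ._≤ fromℕ m ℚ.+ fromℕ (n ℕ.∸ m)) (ℚ.+-identityʳ _)
      (ℚ.+-monoʳ-≤ (fromℕ m) (0≤fromℕ (n ℕ.∸ m))))

-- A denominator is at least 1, so p is at most the absolute value of its numerator.
fromℕ-unbounded : ∀ p → ∃[ n ] p ℚ.< fromℕ (suc n)
fromℕ-unbounded p@(mkℚ z d _) = ℤ.∣ z ∣ , ℚ.toℚᵘ-cancel-<
    (ℚᵘ.<-respʳ-≃ (ℚᵘ.≃-sym (fromℤ-toℚᵘ (+ suc ℤ.∣ z ∣)))
  (ℚᵘ.*<* (begin-strict
    z ℤ.* 1ℤ                      ≡⟨ ℤ.*-identityʳ z ⟩
    z                             ≤⟨ z≤∣z∣ z ⟩
    + ℤ.∣ z ∣                     <⟨ ℤ.+<+ (ℕ.n<1+n ℤ.∣ z ∣) ⟩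
    + suc ℤ.∣ z ∣                 ≤⟨ ℤ.+≤+ (ℕ.m≤m*n (suc ℤ.∣ z ∣) (suc d)) ⟩
    + (suc ℤ.∣ z ∣ ℕ.* suc d)     ≡⟨ ℤ.pos-* (suc ℤ.∣ z ∣) (suc d) ⟩
    + suc ℤ.∣ z ∣ ℤ.* + suc d     ∎)))
  where
  open ℤ.≤-Reasoning
  z≤∣z∣ : ∀ z → z ℤ.≤ + ℤ.∣ z ∣
  z≤∣z∣ (+ n)       = ℤ.≤-refl
  z≤∣z∣ (ℤ.-[1+ n ]) = ℤ.-≤+

-- Phrased for errors q that decay like p/(n + 1), with no division: `newton` and `sqrtᴿ` both
-- control their errors in this form.
archimedean : ∀ p {ε} → 0ℚ ℚ.< ε →
  ∃[ N ] (∀ {n} → N ℕ.≤ n → ∀ q → fromℕ (suc n) ℚ.* q ℚ.≤ p → q ℚ.< ε)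
archimedean p {ε} 0<ε =
  let D , 0<D , ε*D≡1 = reciprocal 0<ε
      N , pD<N = fromℕ-unbounded (p ℚ.* D)
  in N , λ {n} N≤n q nq≤p → ℚ.*-cancelˡ-<-nonNeg (fromℕ (suc n)) {{ℚ.nonNegative (0≤fromℕ (suc n))}} (begin-strict
    fromℕ (suc n) ℚ.* q    ≤⟨ nq≤p ⟩
    p                      ≡⟨ ℚ.*-identityʳ p ⟨
    p ℚ.* 1ℚ               ≡⟨ cong (p ℚ.*_) ε*D≡1 ⟨
    p ℚ.* (ε ℚ.* D)        ≡⟨ solve 3 (λ p e d → p :* (e :* d) := (p :* d) :* e) refl p ε D ⟩
    p ℚ.* D ℚ.* ε          <⟨ ℚ.*-monoˡ-<-pos ε {{ℚ.positive 0<ε}}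
        (ℚ.<-≤-trans pD<N (fromℕ-mono (ℕ.s≤s N≤n))) ⟩
    fromℕ (suc n) ℚ.* ε    ∎)
  where open ℚ.≤-Reasoning

-- One Newton step replaces x by x − h with 2xh = x² − q; the new error is h² ≤ xh.
newton : ∀ {q} → 0ℚ ℚ.≤ q → ∀ n →
  ∃[ x ] 0ℚ ℚ.< x × 0ℚ ℚ.≤ x ℚ.* x ℚ.- q × fromℕ (suc n) ℚ.* (x ℚ.* x ℚ.- q) ℚ.≤ 1ℚ ℚ.+ q ℚ.+ q ℚ.* q
-- The start 1 + q is positive and lies above the root for every q ≥ 0; its error is 1 + q + q²,
-- whence the constant in the bound.
newton {q} 0≤q zero = 1ℚ ℚ.+ q , 0<1+q , 0≤e , ℚ.≤-reflexive e≡
  where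
  0<1+q : 0ℚ ℚ.< 1ℚ ℚ.+ q
  0<1+q = ℚ.+-mono-<-≤ (ℚ.positive⁻¹ 1ℚ) 0≤q
  e≡ : 1ℚ ℚ.* ((1ℚ ℚ.+ q) ℚ.* (1ℚ ℚ.+ q) ℚ.- q) ≡ 1ℚ ℚ.+ q ℚ.+ q ℚ.* q
  e≡ = solve 1 (λ q → con 1ℚ :* ((con 1ℚ :+ q) :* (con 1ℚ :+ q) :- q) := con 1ℚ :+ q :+ q :* q) refl q
  0≤e : 0ℚ ℚ.≤ (1ℚ ℚ.+ q) ℚ.* (1ℚ ℚ.+ q) ℚ.- q
  0≤e = subst (0ℚ ℚ.≤_) (trans (sym e≡) (ℚ.*-identityˡ _)) (ℚ.+-mono-≤ (ℚ.<⇒≤ 0<1+q) (0≤p*p q))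
newton {q} 0≤q (suc n) = x ℚ.- h , 0<x-h , subst (0ℚ ℚ.≤_) (sym e′≡) (0≤p*p h) , (begin
    fromℕ (suc (suc n)) ℚ.* ((x ℚ.- h) ℚ.* (x ℚ.- h) ℚ.- q)
      ≡⟨ cong₂ ℚ._*_ (fromℕ-suc (suc n)) e′≡ ⟩
    -- The factor grows from N to 1 + N ≤ 2N, while the error falls from e to h² ≤ xh = e/2, so the
    -- product does not grow.
    (1ℚ ℚ.+ N) ℚ.* (h ℚ.* h)
      ≤⟨ *-mono-≤ (0≤p*p h) (ℚ.+-mono-≤ (0≤fromℕ (suc n)) (0≤fromℕ (suc n))) (ℚ.+-monoˡ-≤ N 1≤N)
           h²≤hx ⟩
    (N ℚ.+ N) ℚ.* (x ℚ.* h)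
      ≡⟨ solve 3 (λ n x h → (n :+ n) :* (x :* h) := n :* (x :* h :+ x :* h)) refl N x h ⟩
    N ℚ.* (x ℚ.* h ℚ.+ x ℚ.* h)
      ≡⟨ cong (N ℚ.*_) 2xh≡e ⟩
    N ℚ.* e
      ≤⟨ Ne≤ ⟩
    1ℚ ℚ.+ q ℚ.+ q ℚ.* q ∎)
  where
  open ℚ.≤-Reasoning
  N x e y h : ℚ
  N = fromℕ (suc n)
  x = proj₁ (newton 0≤q n)
  0<x = proj₁ (proj₂ (newton 0≤q n))
  0≤e = proj₁ (proj₂ (proj₂ (newton 0≤q n)))
  Ne≤ = proj₂ (proj₂ (proj₂ (newton 0≤q n)))
  e = x ℚ.* x ℚ.- q
  y = proj₁ (reciprocal 0<x)
  0<y = proj₁ (proj₂ (reciprocal 0<x))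
  xy≡1 = proj₂ (proj₂ (reciprocal 0<x))
  h = ½ ℚ.* (e ℚ.* y)
  2xh≡e : x ℚ.* h ℚ.+ x ℚ.* h ≡ e
  2xh≡e = trans (solve 3 (λ x e y → x :* (con ½ :* (e :* y)) :+ x :* (con ½ :* (e :* y))
      := e :* (x :* y)) refl x e y)
    (trans (cong (e ℚ.*_) xy≡1) (ℚ.*-identityʳ e))
  e′≡ : (x ℚ.- h) ℚ.* (x ℚ.- h) ℚ.- q ≡ h ℚ.* h
  e′≡ = trans (solve 3 (λ x h q → (x :- h) :* (x :- h) :- q := (x :* x :- q) :- (x :* h :+ x :* h)
      :+ h :* h) refl x h q)
    (trans (cong (λ t → e ℚ.- t ℚ.+ h ℚ.* h) 2xh≡e)
      (solve 2 (λ e h → e :- e :+ h :* h := h :* h) refl e h))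
  0≤h : 0ℚ ℚ.≤ h
  0≤h = ℚ.nonNegative⁻¹ h {{ℚ.nonNeg*nonNeg⇒nonNeg ½ (e ℚ.* y)
      {{ℚ.nonNeg*nonNeg⇒nonNeg e {{ℚ.nonNegative 0≤e}} y {{ℚ.nonNegative (ℚ.<⇒≤ 0<y)}}}}}}
  -- Cancel x in 2xh = x² - q ≤ x². It follows that the next iterate is at least x/2, hence
  -- positive.
  2h≤x : h ℚ.+ h ℚ.≤ x
  2h≤x = ℚ.*-cancelˡ-≤-pos x {{ℚ.positive 0<x}} (begin
    x ℚ.* (h ℚ.+ h)             ≡⟨ trans (ℚ.*-distribˡ-+ x h h) 2xh≡e ⟩
    x ℚ.* x ℚ.- q               ≤⟨ ℚ.+-monoʳ-≤ (x ℚ.* x) (ℚ.neg-antimono-≤ 0≤q) ⟩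
    x ℚ.* x ℚ.+ 0ℚ              ≡⟨ ℚ.+-identityʳ _ ⟩
    x ℚ.* x                     ∎)
  h≤x : h ℚ.≤ x
  h≤x = ℚ.≤-trans (subst (ℚ._≤ h ℚ.+ h) (ℚ.+-identityʳ h) (ℚ.+-monoʳ-≤ h 0≤h)) 2h≤x
  h²≤hx : h ℚ.* h ℚ.≤ x ℚ.* h
  h²≤hx = ℚ.*-monoʳ-≤-nonNeg h {{ℚ.nonNegative 0≤h}} h≤x
  1≤N : 1ℚ ℚ.≤ N
  1≤N = fromℕ-mono {1} {suc n} (ℕ.s≤s ℕ.z≤n)
  0<x-h : 0ℚ ℚ.< x ℚ.- h
  0<x-h = ℚ.<-≤-trans (half-pos 0<x) (begin
    ½ ℚ.* x
      ≡⟨ solve 1 (λ x → con ½ :* x := x :- con ½ :* x) refl x ⟩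
    x ℚ.- ½ ℚ.* x
      ≤⟨ ℚ.+-monoʳ-≤ x (ℚ.neg-antimono-≤ (begin
           h                       ≡⟨ half+half h ⟨
           ½ ℚ.* h ℚ.+ ½ ℚ.* h     ≡⟨ ℚ.*-distribˡ-+ ½ h h ⟨
           ½ ℚ.* (h ℚ.+ h)         ≤⟨ ℚ.*-monoˡ-≤-nonNeg ½ 2h≤x ⟩
           ½ ℚ.* x                 ∎)) ⟩
    x ℚ.- h ∎)

abstract
  approximate-sqrt : ∀ {q} → 0ℚ ℚ.≤ q → ∀ {ε} → 0ℚ ℚ.< ε →
    ∃[ x ] 0ℚ ℚ.≤ x × ∣ x ℚ.* x ℚ.- q ∣ ℚ.< ε
  approximate-sqrt {q} 0≤q 0<ε =
    let N , small = archimedean (1ℚ ℚ.+ q ℚ.+ q ℚ.* q) 0<ε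
        x , 0<x , 0≤e , Ne≤ = newton 0≤q N
    in x , ℚ.<⇒≤ 0<x , subst (ℚ._< _) (sym (ℚ.0≤p⇒∣p∣≡p 0≤e)) (small ℕ.≤-refl _ Ne≤)

-- Cauchy sequences and real numbers

Eventually : (ℕ → Set) → Set
Eventually P = ∃[ N ] (∀ {n} → N ℕ.≤ n → P n)

map-eventually : ∀ {P Q : ℕ → Set} → (∀ {n} → P n → Q n) → Eventually P → Eventually Q
map-eventually f (N , p) = N , λ N≤n → f (p N≤n)

zip-eventually : ∀ {P Q R : ℕ → Set} → (∀ {n} → P n → Q n → R n) → Eventually P → Eventually Q →
    Eventually R
zip-eventually f (M , p) (N , q) = M ℕ.⊔ N , λ ≤n →
  f (p (ℕ.m⊔n≤o⇒m≤o M N ≤n)) (q (ℕ.m⊔n≤o⇒n≤o M N ≤n))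

-- `x ≃ᴿ y` says that the difference of the sequences is null, so the laws of `_≃ᴿ_` reduce to
-- closure properties of null sequences.
IsNull : (ℕ → ℚ) → Set
IsNull s = ∀ {ε} → 0ℚ ℚ.< ε → Eventually (λ n → ∣ s n ∣ ℚ.< ε)

IsBounded : (ℕ → ℚ) → Set
IsBounded s = ∃[ K ] 0ℚ ℚ.< K × Eventually (λ n → ∣ s n ∣ ℚ.≤ K)

null-≗ : ∀ {s t} → (∀ n → s n ≡ t n) → IsNull s → IsNull t
null-≗ s≗t s→0 0<ε = map-eventually (λ {n} → subst (λ q → ∣ q ∣ ℚ.< _) (s≗t n)) (s→0 0<ε)

null-0 : ∀ {s} → (∀ n → s n ≡ 0ℚ) → IsNull s
null-0 s≗0 0<ε = 0 , λ {n} _ → subst (λ q → ∣ q ∣ ℚ.< _) (sym (s≗0 n)) 0<ε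

null-neg : ∀ {s} → IsNull s → IsNull (λ n → ℚ.- s n)
null-neg {s} s→0 0<ε = map-eventually (λ {n} → subst (ℚ._< _) (sym (ℚ.∣-p∣≡∣p∣ (s n)))) (s→0 0<ε)

null-+ : ∀ {s t} → IsNull s → IsNull t → IsNull (λ n → s n ℚ.+ t n)
null-+ {s} {t} s→0 t→0 {ε} 0<ε = zip-eventually (λ {n} p q → begin-strict
    ∣ s n ℚ.+ t n ∣            ≤⟨ ℚ.∣p+q∣≤∣p∣+∣q∣ (s n) (t n) ⟩
    ∣ s n ∣ ℚ.+ ∣ t n ∣        <⟨ ℚ.+-mono-< p q ⟩
    ½ ℚ.* ε ℚ.+ ½ ℚ.* ε        ≡⟨ half+half ε ⟩
    ε                          ∎)
  (s→0 (half-pos 0<ε)) (t→0 (half-pos 0<ε))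
  where open ℚ.≤-Reasoning

null-* : ∀ s t → IsBounded s → IsNull t → IsNull (λ n → s n ℚ.* t n)
null-* s t (K , 0<K , s≤K) t→0 {ε} 0<ε =
  let D , 0<D , KD≡1 = reciprocal 0<K
  in zip-eventually (λ {n} sₙ≤K tₙ<Dε → begin-strict
    ∣ s n ℚ.* t n ∣           ≡⟨ ℚ.∣p*q∣≡∣p∣*∣q∣ (s n) (t n) ⟩
    ∣ s n ∣ ℚ.* ∣ t n ∣       ≤⟨ ℚ.*-monoʳ-≤-nonNeg ∣ t n ∣ {{ℚ.∣-∣-nonNeg (t n)}} sₙ≤K ⟩
    K ℚ.* ∣ t n ∣             <⟨ ℚ.*-monoʳ-<-pos K {{ℚ.positive 0<K}} tₙ<Dε ⟩
    K ℚ.* (D ℚ.* ε)           ≡⟨ ℚ.*-assoc K D ε ⟨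
    K ℚ.* D ℚ.* ε             ≡⟨ trans (cong (ℚ._* ε) KD≡1) (ℚ.*-identityˡ ε) ⟩
    ε                         ∎)
  s≤K (t→0 (*-pos 0<D 0<ε))
  where open ℚ.≤-Reasoning

cauchy-bounded : ∀ s → IsCauchy s → IsBounded s
cauchy-bounded s s-cauchy =
  let N , close = s-cauchy (ℚ.positive⁻¹ 1ℚ)
  in 1ℚ ℚ.+ ∣ s N ∣ , ℚ.+-mono-<-≤ (ℚ.positive⁻¹ 1ℚ) (ℚ.0≤∣p∣ (s N)) , N , λ {n} N≤n → begin
    ∣ s n ∣                        ≡⟨ cong ∣_∣ (solve 2 (λ a b → a := a :- b :+ b) refl (s n) (s N)) ⟩
    ∣ s n ℚ.- s N ℚ.+ s N ∣        ≤⟨ ℚ.∣p+q∣≤∣p∣+∣q∣ (s n ℚ.- s N) (s N) ⟩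
    ∣ s n ℚ.- s N ∣ ℚ.+ ∣ s N ∣    ≤⟨ ℚ.+-monoˡ-≤ ∣ s N ∣ (ℚ.<⇒≤ (close N≤n ℕ.≤-refl)) ⟩
    1ℚ ℚ.+ ∣ s N ∣                 ∎
  where open ℚ.≤-Reasoning

-- Two shifts of ε/4 and a Cauchy estimate of ε/2. Needed in `sqrtᴿ`, where the squares of the
-- approximate roots are only known to be close to x.
cauchy-shift : ∀ s t → IsNull (λ n → s n ℚ.- t n) → IsCauchy t → IsCauchy s
cauchy-shift s t s-t→0 t-cauchy {ε} 0<ε =
  let M , p = s-t→0 (half-pos (half-pos 0<ε))
      N , q = t-cauchy (half-pos 0<ε)
  in M ℕ.⊔ N , λ {m} {n} ≤m ≤n → begin-strict
    ∣ s m ℚ.- s n ∣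
      ≡⟨ cong ∣_∣ (solve 4 (λ a b c d → a :- b := (a :- c) :- (b :- d) :+ (c :- d)) refl (s m) (s n)
           (t m) (t n)) ⟩
    ∣ (s m ℚ.- t m) ℚ.- (s n ℚ.- t n) ℚ.+ (t m ℚ.- t n) ∣
      ≤⟨ ℚ.∣p+q∣≤∣p∣+∣q∣ ((s m ℚ.- t m) ℚ.- (s n ℚ.- t n)) (t m ℚ.- t n) ⟩
    ∣ (s m ℚ.- t m) ℚ.- (s n ℚ.- t n) ∣ ℚ.+ ∣ t m ℚ.- t n ∣
      ≤⟨ ℚ.+-monoˡ-≤ ∣ t m ℚ.- t n ∣ (ℚ.∣p-q∣≤∣p∣+∣q∣ (s m ℚ.- t m) (s n ℚ.- t n)) ⟩
    ∣ s m ℚ.- t m ∣ ℚ.+ ∣ s n ℚ.- t n ∣ ℚ.+ ∣ t m ℚ.- t n ∣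
      <⟨ ℚ.+-mono-< (ℚ.+-mono-< (p (ℕ.m⊔n≤o⇒m≤o M N ≤m)) (p (ℕ.m⊔n≤o⇒m≤o M N ≤n)))
           (q (ℕ.m⊔n≤o⇒n≤o M N ≤m) (ℕ.m⊔n≤o⇒n≤o M N ≤n)) ⟩
    ½ ℚ.* (½ ℚ.* ε) ℚ.+ ½ ℚ.* (½ ℚ.* ε) ℚ.+ ½ ℚ.* ε
      ≡⟨ solve 1 (λ e → con ½ :* (con ½ :* e) :+ con ½ :* (con ½ :* e) :+ con ½ :* e := e) refl ε ⟩
    ε ∎
  where open ℚ.≤-Reasoning

null⇒≃ : ∀ {x y} → IsNull (λ n → seq x n ℚ.- seq y n) → x ≃ᴿ y
null⇒≃ x-y→0 = mk≃ᴿ λ 0<ε → x-y→0 0<ε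

≃⇒null : ∀ {x y} → x ≃ᴿ y → IsNull (λ n → seq x n ℚ.- seq y n)
≃⇒null x≃y 0<ε = _≃ᴿ_.close x≃y 0<ε

pointwise : ∀ {x y} → (∀ n → seq x n ≡ seq y n) → x ≃ᴿ y
pointwise {x} {y} x≗y = null⇒≃ (null-0 (λ n → trans (cong (ℚ._- seq y n) (x≗y n))
    (ℚ.+-inverseʳ (seq y n))))

≃-refl : ∀ {x} → x ≃ᴿ x
≃-refl = pointwise (λ _ → refl)

≃-sym : ∀ {x y} → x ≃ᴿ y → y ≃ᴿ x
≃-sym {x} {y} x≃y = null⇒≃ (null-≗ (λ n → solve 2 (λ a b → :- (a :- b) := b :- a) refl (seq x n)
    (seq y n)) (null-neg (≃⇒null x≃y)))

≃-trans : ∀ {x y z} → x ≃ᴿ y → y ≃ᴿ z → x ≃ᴿ z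
≃-trans {x} {y} {z} x≃y y≃z = null⇒≃ (null-≗
  (λ n → solve 3 (λ a b c → (a :- b) :+ (b :- c) := a :- c) refl (seq x n) (seq y n) (seq z n))
  (null-+ (≃⇒null x≃y) (≃⇒null y≃z)))

+ᴿ-cong : ∀ {x x′ y y′} → x ≃ᴿ x′ → y ≃ᴿ y′ → x +ᴿ y ≃ᴿ x′ +ᴿ y′
+ᴿ-cong {x} {x′} {y} {y′} x≃x′ y≃y′ = null⇒≃ (null-≗
  (λ n → solve 4 (λ a a′ b b′ → (a :- a′) :+ (b :- b′) := (a :+ b) :- (a′ :+ b′)) refl (seq x n)
      (seq x′ n) (seq y n) (seq y′ n))
  (null-+ (≃⇒null x≃x′) (≃⇒null y≃y′)))

-ᴿ-cong : ∀ {x x′} → x ≃ᴿ x′ → -ᴿ x ≃ᴿ -ᴿ x′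
-ᴿ-cong {x} {x′} x≃x′ = null⇒≃ (null-≗
  (λ n → solve 2 (λ a a′ → :- (a :- a′) := (:- a) :- (:- a′)) refl (seq x n) (seq x′ n))
      (null-neg (≃⇒null x≃x′)))

*ᴿ-cong : ∀ {x x′ y y′} → x ≃ᴿ x′ → y ≃ᴿ y′ → x *ᴿ y ≃ᴿ x′ *ᴿ y′
*ᴿ-cong {x} {x′} {y} {y′} x≃x′ y≃y′ = null⇒≃ (null-≗
  (λ n → solve 4 (λ a a′ b b′ → a :* (b :- b′) :+ b′ :* (a :- a′) := a :* b :- a′ :* b′) refl
      (seq x n) (seq x′ n) (seq y n) (seq y′ n))
  (null-+ (null-* (seq x) (λ n → seq y n ℚ.- seq y′ n) (cauchy-bounded (seq x) (cauchy x))
      (≃⇒null y≃y′))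
          (null-* (seq y′) (λ n → seq x n ℚ.- seq x′ n) (cauchy-bounded (seq y′) (cauchy y′))
              (≃⇒null x≃x′))))

0≤ᴿ-pointwise : ∀ {x} → (∀ n → 0ℚ ℚ.≤ seq x n) → 0ᴿ ≤ᴿ x
0≤ᴿ-pointwise 0≤x = mk≤ᴿ λ 0<ε → 0 , λ {n} _ → ℚ.+-mono-≤-< (0≤x n) 0<ε

0≤ᴿ-resp : ∀ {x y} → x ≃ᴿ y → 0ᴿ ≤ᴿ x → 0ᴿ ≤ᴿ y
0≤ᴿ-resp {x} {y} x≃y 0≤x = mk≤ᴿ λ {ε} 0<ε → zip-eventually (λ {n} p q → begin-strict
    0ℚ                                                      <⟨ p ⟩
    seq x n ℚ.+ ½ ℚ.* ε                                     ≡⟨ solve 3 (λ a b e → a :+ e := b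
        :+ (e :+ (a :- b))) refl (seq x n) (seq y n) (½ ℚ.* ε) ⟩
    seq y n ℚ.+ (½ ℚ.* ε ℚ.+ (seq x n ℚ.- seq y n))
        <⟨ ℚ.+-monoʳ-< (seq y n) (ℚ.+-monoʳ-< (½ ℚ.* ε) (∣∣<⇒< q)) ⟩
    seq y n ℚ.+ (½ ℚ.* ε ℚ.+ ½ ℚ.* ε)                       ≡⟨ cong (seq y n ℚ.+_) (half+half ε) ⟩
    seq y n ℚ.+ ε                                           ∎)
  (_≤ᴿ_.below 0≤x (half-pos 0<ε)) (≃⇒null x≃y (half-pos 0<ε))
  where open ℚ.≤-Reasoning

0≤ᴿ-+ : ∀ {x y} → 0ᴿ ≤ᴿ x → 0ᴿ ≤ᴿ y → 0ᴿ ≤ᴿ x +ᴿ y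
0≤ᴿ-+ {x} {y} 0≤x 0≤y = mk≤ᴿ λ {ε} 0<ε → zip-eventually (λ {n} p q → subst (0ℚ ℚ.<_)
    (solve 3 (λ a b e → (a :+ con ½ :* e) :+ (b :+ con ½ :* e) := a :+ b :+ e) refl (seq x n)
        (seq y n) ε)
    (ℚ.+-mono-< p q))
  (_≤ᴿ_.below 0≤x (half-pos 0<ε)) (_≤ᴿ_.below 0≤y (half-pos 0<ε))

≤ᴿ⇒0≤ᴿ- : ∀ {x y} → x ≤ᴿ y → 0ᴿ ≤ᴿ y -ᴿ x
≤ᴿ⇒0≤ᴿ- {x} {y} x≤y = mk≤ᴿ λ {ε} 0<ε → map-eventually (λ {n} p → begin-strict
    0ℚ                                      ≡⟨ ℚ.+-inverseʳ (seq x n) ⟨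
    seq x n ℚ.- seq x n                     <⟨ ℚ.+-monoˡ-< (ℚ.- seq x n) p ⟩
    seq y n ℚ.+ ε ℚ.- seq x n               ≡⟨ solve 3 (λ a b e → b :+ e :- a := b :- a
        :+ e) refl (seq x n) (seq y n) ε ⟩
    seq y n ℚ.- seq x n ℚ.+ ε               ∎)
  (_≤ᴿ_.below x≤y 0<ε)
  where open ℚ.≤-Reasoning

≃⇒≤ᴿ : ∀ {x y} → x ≃ᴿ y → x ≤ᴿ y
≃⇒≤ᴿ {x} {y} x≃y = mk≤ᴿ λ {ε} 0<ε → map-eventually (λ {n} p → begin-strict
    seq x n                                 ≡⟨ solve 2 (λ a b → a := b :+ (a :- b)) refl (seq x n)
        (seq y n) ⟩
    seq y n ℚ.+ (seq x n ℚ.- seq y n)       <⟨ ℚ.+-monoʳ-< (seq y n) (∣∣<⇒< p) ⟩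
    seq y n ℚ.+ ε                           ∎)
  (≃⇒null x≃y 0<ε)
  where open ℚ.≤-Reasoning

-- The bound on x from below is the hypothesis; from above, x = (x + y) - y with x + y < ε/2 and -y
-- < ε/2 eventually.
0≤ᴿ-vanish : ∀ {x y} → 0ᴿ ≤ᴿ x → 0ᴿ ≤ᴿ y → x +ᴿ y ≃ᴿ 0ᴿ → x ≃ᴿ 0ᴿ
0≤ᴿ-vanish {x} {y} 0≤x 0≤y x+y≃0 = null⇒≃ λ {ε} 0<ε → zip-eventually (λ {n} p (q , r) → ∣∣<-intro
    (begin-strict
      seq x n ℚ.- 0ℚ
        ≡⟨ solve 2 (λ a b → a :- con 0ℚ := con 0ℚ :+ (a :+ b :- con 0ℚ) :- b) refl (seq x n)
             (seq y n) ⟩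
      0ℚ ℚ.+ (seq x n ℚ.+ seq y n ℚ.- 0ℚ) ℚ.- seq y n
        <⟨ ℚ.+-monoˡ-< (ℚ.- seq y n) (ℚ.+-mono-< q (∣∣<⇒< r)) ⟩
      seq y n ℚ.+ ½ ℚ.* ε ℚ.+ ½ ℚ.* ε ℚ.- seq y n
        ≡⟨ solve 2 (λ b e → b :+ con ½ :* e :+ con ½ :* e :- b := e) refl (seq y n) ε ⟩
      ε ∎)
    (begin-strict
      ℚ.- (seq x n ℚ.- 0ℚ)
        ≡⟨ solve 1 (λ a → :- (a :- con 0ℚ) := con 0ℚ :- a) refl (seq x n) ⟩
      0ℚ ℚ.- seq x n
        <⟨ ℚ.+-monoˡ-< (ℚ.- seq x n) p ⟩
      seq x n ℚ.+ ε ℚ.- seq x n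
        ≡⟨ solve 2 (λ a e → a :+ e :- a := e) refl (seq x n) ε ⟩
      ε ∎))
  (_≤ᴿ_.below 0≤x 0<ε)
  (zip-eventually _,_ (_≤ᴿ_.below 0≤y (half-pos 0<ε)) (≃⇒null x+y≃0 (half-pos 0<ε)))
  where open ℚ.≤-Reasoning

square-≃0 : ∀ {x} → x *ᴿ x ≃ᴿ 0ᴿ → x ≃ᴿ 0ᴿ
square-≃0 {x} x²≃0 = null⇒≃ λ {ε} 0<ε → map-eventually
    (λ {n} p → square-cancel-< 0<ε (subst (ℚ._< ε ℚ.* ε)
    (trans (cong ∣_∣ (solve 1 (λ a → a :* a :- con 0ℚ := (a :- con 0ℚ) :* (a :- con 0ℚ)) refl
        (seq x n)))
      (ℚ.∣p*q∣≡∣p∣*∣q∣ (seq x n ℚ.- 0ℚ) (seq x n ℚ.- 0ℚ))) p))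
  (≃⇒null x²≃0 (*-pos 0<ε 0<ε))

-- Strict positivity with evidence: η keeps a tail of the sequence away from zero and later supplies
-- the modulus of the reciprocal.
Positive : ℝ → Set
Positive x = ∃[ η ] 0ℚ ℚ.< η × Eventually (λ n → η ℚ.≤ seq x n)

positive-resp : ∀ {x y} → x ≃ᴿ y → Positive x → Positive y
positive-resp {x} {y} x≃y (η , 0<η , η≤x) = ½ ℚ.* η , half-pos 0<η , zip-eventually (λ {n} p q → begin
    ½ ℚ.* η                                       ≡⟨ solve 1 (λ e → con ½ :* e := e :- con ½ :* e)
        refl η ⟩
    η ℚ.- ½ ℚ.* η
        ≤⟨ ℚ.+-mono-≤ p (ℚ.neg-antimono-≤ (ℚ.<⇒≤ (∣∣<⇒< q))) ⟩
    seq x n ℚ.- (seq x n ℚ.- seq y n)             ≡⟨ solve 2 (λ a b → a :- (a :- b)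
        := b) refl (seq x n) (seq y n) ⟩
    seq y n                                       ∎)
  η≤x (≃⇒null x≃y (half-pos 0<η))
  where open ℚ.≤-Reasoning

-- One term beyond the Cauchy modulus for η/2 decides: if it is at least η, all later terms are at
-- least η/2. The modulus is an argument, so that the caller can choose K beyond it.
positive-term : ∀ x {η} → 0ℚ ℚ.< η → (c : ∃[ N ] (∀ {m n} → N ℕ.≤ m → N ℕ.≤ n →
    ∣ seq x m ℚ.- seq x n ∣ ℚ.< ½ ℚ.* η)) →
  ∀ {K} → proj₁ c ℕ.≤ K → η ℚ.≤ seq x K → Positive x
positive-term x {η} 0<η (N , close) {K} N≤K η≤xK = ½ ℚ.* η , half-pos 0<η , N , λ {n} N≤n → begin
    ½ ℚ.* η                                       ≡⟨ solve 1 (λ e → con ½ :* e := e :- con ½ :* e)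
        refl η ⟩
    η ℚ.- ½ ℚ.* η
        ≤⟨ ℚ.+-mono-≤ η≤xK (ℚ.neg-antimono-≤ (ℚ.<⇒≤ (∣∣<⇒< (close N≤K N≤n)))) ⟩
    seq x K ℚ.- (seq x K ℚ.- seq x n)             ≡⟨ solve 2 (λ a b → a :- (a :- b)
        := b) refl (seq x K) (seq x n) ⟩
    seq x n                                       ∎
  where open ℚ.≤-Reasoning

-- Comparing reals is undecidable, but comparing one rational term is not. At an index K beyond all
-- moduli the terms of x and y add up to at least η, so one of them is at least η/2, and
-- `positive-term` spreads this to the tail.
positive-+ : ∀ x y → Positive (x +ᴿ y) → Positive x ⊎ Positive y
positive-+ x y (η , 0<η , N , η≤x+y)
  with cauchy x (half-pos (half-pos 0<η)) | cauchy y (half-pos (half-pos 0<η))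
... | cx@(Nx , _) | cy@(Ny , _) with ½ ℚ.* η ℚ.≤? seq x (N ℕ.⊔ (Nx ℕ.⊔ Ny))
...   | yes η/2≤x = inj₁ (positive-term x (half-pos 0<η) cx
    (ℕ.≤-trans (ℕ.m≤m⊔n Nx Ny) (ℕ.m≤n⊔m N (Nx ℕ.⊔ Ny))) η/2≤x)
...   | no  η/2≰x = inj₂ (positive-term y (half-pos 0<η) cy
    (ℕ.≤-trans (ℕ.m≤n⊔m Nx Ny) (ℕ.m≤n⊔m N (Nx ℕ.⊔ Ny))) (begin
    ½ ℚ.* η                                       ≡⟨ solve 1 (λ e → con ½ :* e := e :- con ½ :* e)
        refl η ⟩
    η ℚ.- ½ ℚ.* η
        ≤⟨ ℚ.+-mono-≤ (η≤x+y (ℕ.m≤m⊔n N (Nx ℕ.⊔ Ny))) (ℚ.neg-antimono-≤ (ℚ.<⇒≤ (ℚ.≰⇒> η/2≰x))) ⟩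
    seq x K ℚ.+ seq y K ℚ.- seq x K
        ≡⟨ solve 2 (λ a b → a :+ b :- a := b) refl (seq x K) (seq y K) ⟩
    seq y K                                       ∎))
  where
  open ℚ.≤-Reasoning
  K : ℕ
  K = N ℕ.⊔ (Nx ℕ.⊔ Ny)

abstract
  -- The terms are 1/max(xₙ, η), which makes sense at every n and agrees with 1/xₙ on the tail. The
  -- maximum also makes every term nonnegative, as `sqrtᴿ` demands.
  reciprocalᴿ : ∀ {x} → Positive x → ∃[ y ] (∀ n → 0ℚ ℚ.≤ seq y n) × y *ᴿ x ≃ᴿ 1ᴿ
  reciprocalᴿ {x} (η , 0<η , N , η≤x) = mkℝ r r-cauchy , (λ n → ℚ.<⇒≤ (0<r n)) , null⇒≃ λ 0<ε →
      N , λ {n} N≤n → subst (λ q → ∣ q ∣ ℚ.< _)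
        (sym (trans (cong (ℚ._- 1ℚ) (trans (ℚ.*-comm (r n) (seq x n)) (xr≡1 N≤n)))
            (ℚ.+-inverseʳ 1ℚ))) 0<ε
    where
    open ℚ.≤-Reasoning
    0<x⊔η : ∀ n → 0ℚ ℚ.< seq x n ℚ.⊔ η
    0<x⊔η n = ℚ.<-≤-trans 0<η (ℚ.p≤q⊔p (seq x n) η)
    r : ℕ → ℚ
    r n = proj₁ (reciprocal (0<x⊔η n))
    0<r : ∀ n → 0ℚ ℚ.< r n
    0<r n = proj₁ (proj₂ (reciprocal (0<x⊔η n)))
    xr≡1 : ∀ {n} → N ℕ.≤ n → seq x n ℚ.* r n ≡ 1ℚ
    xr≡1 {n} N≤n = trans (cong (ℚ._* r n) (sym (ℚ.p≥q⇒p⊔q≡p (η≤x N≤n))))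
        (proj₂ (proj₂ (reciprocal (0<x⊔η n))))
    ηr≤1 : ∀ {n} → N ℕ.≤ n → η ℚ.* r n ℚ.≤ 1ℚ
    ηr≤1 {n} N≤n = ℚ.≤-trans (ℚ.*-monoʳ-≤-nonNeg (r n) {{ℚ.nonNegative (ℚ.<⇒≤ (0<r n))}} (η≤x N≤n))
        (ℚ.≤-reflexive (xr≡1 N≤n))
    r-cauchy : IsCauchy r
    r-cauchy {ε} 0<ε =
      -- 1/a - 1/b = (b - a)/(ab), and both reciprocals are at most 1/η, so closeness η² ε of the
      -- terms of x suffices.
      let M , close = cauchy x (*-pos (*-pos 0<η 0<η) 0<ε)
      in N ℕ.⊔ M , λ {m} {n} ≤m ≤n →
        let N≤m = ℕ.m⊔n≤o⇒m≤o N M ≤m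
            N≤n = ℕ.m⊔n≤o⇒m≤o N M ≤n
            instance
              η²-nonNeg : ℚ.NonNegative (η ℚ.* η)
              η²-nonNeg = ℚ.nonNegative (0≤p*p η)
        in ℚ.*-cancelˡ-<-nonNeg (η ℚ.* η) (begin-strict
          η ℚ.* η ℚ.* ∣ r m ℚ.- r n ∣
            ≡⟨ cong (λ q → η ℚ.* η ℚ.* ∣ q ∣) (difference (seq x m) (seq x n) (r m) (r n) (xr≡1 N≤m)
                 (xr≡1 N≤n)) ⟩
          η ℚ.* η ℚ.* ∣ r m ℚ.* r n ℚ.* (seq x n ℚ.- seq x m) ∣
            ≡⟨ cong (η ℚ.* η ℚ.*_) (trans (ℚ.∣p*q∣≡∣p∣*∣q∣ (r m ℚ.* r n) _)
                 (cong₂ ℚ._*_ (ℚ.0≤p⇒∣p∣≡p (ℚ.<⇒≤ (*-pos (0<r m) (0<r n))))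
                 (∣-∣-comm (seq x n) (seq x m)))) ⟩
          η ℚ.* η ℚ.* (r m ℚ.* r n ℚ.* ∣ seq x m ℚ.- seq x n ∣)
            ≡⟨ solve 4 (λ e a b z → e :* e :* (a :* b :* z) := e :* a :* (e :* b) :* z) refl η (r m)
                 (r n) _ ⟩
          η ℚ.* r m ℚ.* (η ℚ.* r n) ℚ.* ∣ seq x m ℚ.- seq x n ∣
            ≤⟨ ℚ.*-monoʳ-≤-nonNeg ∣ seq x m ℚ.- seq x n ∣ {{ℚ.∣-∣-nonNeg (seq x m ℚ.- seq x n)}}
                 (*-mono-≤ (ℚ.<⇒≤ (*-pos 0<η (0<r n))) (ℚ.nonNegative⁻¹ 1ℚ) (ηr≤1 N≤m) (ηr≤1 N≤n)) ⟩
          1ℚ ℚ.* 1ℚ ℚ.* ∣ seq x m ℚ.- seq x n ∣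
            ≡⟨ ℚ.*-identityˡ _ ⟩
          ∣ seq x m ℚ.- seq x n ∣
            <⟨ close (ℕ.m⊔n≤o⇒n≤o N M ≤m) (ℕ.m⊔n≤o⇒n≤o N M ≤n) ⟩
          η ℚ.* η ℚ.* ε ∎)
      where
      difference : ∀ a b p q → a ℚ.* p ≡ 1ℚ → b ℚ.* q ≡ 1ℚ → p ℚ.- q ≡ p ℚ.* q ℚ.* (b ℚ.- a)
      difference a b p q ap≡1 bq≡1 = sym (trans
        (solve 4 (λ a b p q → p :* q :* (b :- a) := b :* q :* p :- a :* p :* q) refl a b p q)
        (trans (cong₂ (λ s t → s ℚ.* p ℚ.- t ℚ.* q) bq≡1 ap≡1)
          (solve 2 (λ p q → con 1ℚ :* p :- con 1ℚ :* q := p :- q) refl p q)))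

abstract
  -- The nth term is a nonnegative rational whose square is within 1/(n + 1) of xₙ. For a, b ≥ 0 one
  -- has |a - b|² ≤ |a - b| (a + b) = |a² - b²|, so closeness ε² of the squares gives closeness ε of
  -- the roots, even near zero.
  sqrtᴿ : ∀ x → (∀ n → 0ℚ ℚ.≤ seq x n) → ∃[ s ] s *ᴿ s ≃ᴿ x
  sqrtᴿ x 0≤x = mkℝ s s-cauchy , null⇒≃ s²-x→0
    where
    open ℚ.≤-Reasoning
    step : ∀ n → ∃[ d ] 0ℚ ℚ.< d × fromℕ (suc n) ℚ.* d ≡ 1ℚ
    step n = reciprocal (0<fromℕ-suc n)
    root : ∀ n → ∃[ t ] 0ℚ ℚ.≤ t × ∣ t ℚ.* t ℚ.- seq x n ∣ ℚ.< proj₁ (step n)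
    root n = approximate-sqrt (0≤x n) (proj₁ (proj₂ (step n)))
    s : ℕ → ℚ
    s n = proj₁ (root n)
    s²-x→0 : IsNull (λ n → s n ℚ.* s n ℚ.- seq x n)
    s²-x→0 0<ε = map-eventually
      (λ {n} small → ℚ.<-trans (proj₂ (proj₂ (root n)))
          (small _ (ℚ.≤-reflexive (proj₂ (proj₂ (step n))))))
      (archimedean 1ℚ 0<ε)
    s-cauchy : IsCauchy s
    s-cauchy {ε} 0<ε =
      let N , close = cauchy-shift (λ n → s n ℚ.* s n) (seq x) s²-x→0 (cauchy x) (*-pos 0<ε 0<ε)
      in N , λ {m} {n} N≤m N≤n → square-cancel-< 0<ε (begin-strict
        ∣ s m ℚ.- s n ∣ ℚ.* ∣ s m ℚ.- s n ∣
          ≤⟨ ℚ.*-monoˡ-≤-nonNeg ∣ s m ℚ.- s n ∣ {{ℚ.∣-∣-nonNeg (s m ℚ.- s n)}}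
               (ℚ.∣p-q∣≤∣p∣+∣q∣ (s m) (s n)) ⟩
        ∣ s m ℚ.- s n ∣ ℚ.* (∣ s m ∣ ℚ.+ ∣ s n ∣)
          ≡⟨ cong (∣ s m ℚ.- s n ∣ ℚ.*_)
               (trans (cong₂ ℚ._+_ (∣s∣ m) (∣s∣ n)) (sym (ℚ.0≤p⇒∣p∣≡p (ℚ.+-mono-≤ (0≤s m) (0≤s n)))))
               ⟩
        ∣ s m ℚ.- s n ∣ ℚ.* ∣ s m ℚ.+ s n ∣
          ≡⟨ ℚ.∣p*q∣≡∣p∣*∣q∣ (s m ℚ.- s n) (s m ℚ.+ s n) ⟨
        ∣ (s m ℚ.- s n) ℚ.* (s m ℚ.+ s n) ∣
          ≡⟨ cong ∣_∣ (solve 2 (λ a b → (a :- b) :* (a :+ b) := a :* a :- b :* b) refl (s m) (s n)) ⟩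
        ∣ s m ℚ.* s m ℚ.- s n ℚ.* s n ∣
          <⟨ close N≤m N≤n ⟩
        ε ℚ.* ε ∎)
      where
      0≤s : ∀ n → 0ℚ ℚ.≤ s n
      0≤s n = proj₁ (proj₂ (root n))
      ∣s∣ : ∀ n → ∣ s n ∣ ≡ s n
      ∣s∣ n = ℚ.0≤p⇒∣p∣≡p (0≤s n)

-- Complex numbers

≃ᶜ-pointwise : ∀ {z w} → (∀ n → seq (re z) n ≡ seq (re w) n) → (∀ n → seq (im z) n ≡ seq (im w) n) →
    z ≃ᶜ w
≃ᶜ-pointwise p q = mk≃ᶜ (pointwise p) (pointwise q)

-ᶜ_ : ℂ → ℂ
-ᶜ (a +i b) = (-ᴿ a) +i (-ᴿ b)

ℂ-commutativeRing : CommutativeRing 0ℓ 0ℓ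
ℂ-commutativeRing = record
  { Carrier = ℂ ; _≈_ = _≃ᶜ_ ; _+_ = _+ᶜ_ ; _*_ = _*ᶜ_ ; -_ = -ᶜ_ ; 0# = 0ᶜ ; 1# = 1ᶜ
  ; isCommutativeRing = record
    { isRing = record
      { +-isAbelianGroup = record
        { isGroup = record
          { isMonoid = record
            { isSemigroup = record
              { isMagma = record
                { isEquivalence = record
                  { refl  = mk≃ᶜ ≃-refl ≃-refl
                  ; sym   = λ (mk≃ᶜ p q) → mk≃ᶜ (≃-sym p) (≃-sym q)
                  ; trans = λ (mk≃ᶜ p q) (mk≃ᶜ r s) → mk≃ᶜ (≃-trans p r) (≃-trans q s)
                  }
                ; ∙-cong = λ (mk≃ᶜ p q) (mk≃ᶜ r s) → mk≃ᶜ (+ᴿ-cong p r) (+ᴿ-cong q s)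
                }
              ; assoc = λ x y z → ≃ᶜ-pointwise
                  (λ n → ℚ.+-assoc (seq (re x) n) (seq (re y) n) (seq (re z) n))
                  (λ n → ℚ.+-assoc (seq (im x) n) (seq (im y) n) (seq (im z) n))
              }
            ; identity =
                (λ x → ≃ᶜ-pointwise (λ n → ℚ.+-identityˡ (seq (re x) n))
                    (λ n → ℚ.+-identityˡ (seq (im x) n))) ,
                (λ x → ≃ᶜ-pointwise (λ n → ℚ.+-identityʳ (seq (re x) n))
                    (λ n → ℚ.+-identityʳ (seq (im x) n)))
            }
          ; inverse =
              (λ x → ≃ᶜ-pointwise (λ n → ℚ.+-inverseˡ (seq (re x) n))
                  (λ n → ℚ.+-inverseˡ (seq (im x) n))) ,
              (λ x → ≃ᶜ-pointwise (λ n → ℚ.+-inverseʳ (seq (re x) n))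
                  (λ n → ℚ.+-inverseʳ (seq (im x) n)))
          ; ⁻¹-cong = λ (mk≃ᶜ p q) → mk≃ᶜ (-ᴿ-cong p) (-ᴿ-cong q)
          }
        ; comm = λ x y → ≃ᶜ-pointwise
            (λ n → ℚ.+-comm (seq (re x) n) (seq (re y) n))
                (λ n → ℚ.+-comm (seq (im x) n) (seq (im y) n))
        }
      ; *-cong = λ (mk≃ᶜ p q) (mk≃ᶜ r s) → mk≃ᶜ
          (+ᴿ-cong (*ᴿ-cong p r) (-ᴿ-cong (*ᴿ-cong q s))) (+ᴿ-cong (*ᴿ-cong p s) (*ᴿ-cong q r))
      ; *-assoc = λ x y z → ≃ᶜ-pointwise
          (λ n → solve 6 (λ a b c d e f → (a :* c :- b :* d) :* e :- (a :* d :+ b :* c) :* f :=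
                            a :* (c :* e :- d :* f) :- b :* (c :* f :+ d :* e)) refl
                   (seq (re x) n) (seq (im x) n) (seq (re y) n) (seq (im y) n) (seq (re z) n)
                       (seq (im z) n))
          (λ n → solve 6 (λ a b c d e f → (a :* c :- b :* d) :* f :+ (a :* d :+ b :* c) :* e :=
                            a :* (c :* f :+ d :* e) :+ b :* (c :* e :- d :* f)) refl
                   (seq (re x) n) (seq (im x) n) (seq (re y) n) (seq (im y) n) (seq (re z) n)
                       (seq (im z) n))
      ; *-identity =
          (λ x → ≃ᶜ-pointwise
            (λ n → solve 2 (λ a b → con 1ℚ :* a :- con 0ℚ :* b := a) refl (seq (re x) n)
                (seq (im x) n))
            (λ n → solve 2 (λ a b → con 1ℚ :* b :+ con 0ℚ :* a := b) refl (seq (re x) n)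
                (seq (im x) n))) ,
          (λ x → ≃ᶜ-pointwise
            (λ n → solve 2 (λ a b → a :* con 1ℚ :- b :* con 0ℚ := a) refl (seq (re x) n)
                (seq (im x) n))
            (λ n → solve 2 (λ a b → a :* con 0ℚ :+ b :* con 1ℚ := b) refl (seq (re x) n)
                (seq (im x) n)))
      ; distrib =
          (λ x y z → ≃ᶜ-pointwise
            (λ n → solve 6 (λ a b c d e f → a :* (c :+ e) :- b :* (d :+ f) :=
                              (a :* c :- b :* d) :+ (a :* e :- b :* f)) refl
                     (seq (re x) n) (seq (im x) n) (seq (re y) n) (seq (im y) n) (seq (re z) n)
                         (seq (im z) n))
            (λ n → solve 6 (λ a b c d e f → a :* (d :+ f) :+ b :* (c :+ e) :=
                              (a :* d :+ b :* c) :+ (a :* f :+ b :* e)) refl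
                     (seq (re x) n) (seq (im x) n) (seq (re y) n) (seq (im y) n) (seq (re z) n)
                         (seq (im z) n))) ,
          (λ x y z → ≃ᶜ-pointwise
            (λ n → solve 6 (λ a b c d e f → (c :+ e) :* a :- (d :+ f) :* b :=
                              (c :* a :- d :* b) :+ (e :* a :- f :* b)) refl
                     (seq (re x) n) (seq (im x) n) (seq (re y) n) (seq (im y) n) (seq (re z) n)
                         (seq (im z) n))
            (λ n → solve 6 (λ a b c d e f → (c :+ e) :* b :+ (d :+ f) :* a :=
                              (c :* b :+ d :* a) :+ (e :* b :+ f :* a)) refl
                     (seq (re x) n) (seq (im x) n) (seq (re y) n) (seq (im y) n) (seq (re z) n)
                         (seq (im z) n)))
      }
    ; *-comm = λ x y → ≃ᶜ-pointwise
        (λ n → solve 4 (λ a b c d → a :* c :- b :* d := c :* a :- d :* b) refl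
                 (seq (re x) n) (seq (im x) n) (seq (re y) n) (seq (im y) n))
        (λ n → solve 4 (λ a b c d → a :* d :+ b :* c := c :* b :+ d :* a) refl
                 (seq (re x) n) (seq (im x) n) (seq (re y) n) (seq (im y) n))
    }
  }

module ℂᴿ = CommutativeRing ℂ-commutativeRing

fromℝ : ℝ → ℂ
fromℝ a = a +i 0ᴿ

fromℝ-cong : ∀ {a b} → a ≃ᴿ b → fromℝ a ≃ᶜ fromℝ b
fromℝ-cong a≃b = mk≃ᶜ a≃b ≃-refl

fromℝ-* : ∀ a b → fromℝ (a *ᴿ b) ≃ᶜ fromℝ a *ᶜ fromℝ b
fromℝ-* a b = ≃ᶜ-pointwise
  (λ n → solve 2 (λ a b → a :* b := a :* b :- con 0ℚ :* con 0ℚ) refl (seq a n) (seq b n))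
  (λ n → solve 2 (λ a b → con 0ℚ := a :* con 0ℚ :+ con 0ℚ :* b) refl (seq a n) (seq b n))

conj-fromℝ : ∀ a → conj (fromℝ a) ≃ᶜ fromℝ a
conj-fromℝ a = ≃ᶜ-pointwise (λ _ → refl) (λ _ → refl)

rational : ℚ → ℂ
rational q = fromℝ (fromℚ q)

rational-cong : ∀ {p q} → p ≡ q → rational p ≃ᶜ rational q
rational-cong refl = ℂᴿ.refl

rational-+ : ∀ p q → rational (p ℚ.+ q) ≃ᶜ rational p +ᶜ rational q
rational-+ p q = ≃ᶜ-pointwise (λ _ → refl) (λ _ → refl)

rational-* : ∀ p q → rational (p ℚ.* q) ≃ᶜ rational p *ᶜ rational q
rational-* p q = ≃ᶜ-pointwise
  (λ _ → solve 2 (λ a b → a :* b := a :* b :- con 0ℚ :* con 0ℚ) refl p q)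
  (λ _ → solve 2 (λ a b → con 0ℚ := a :* con 0ℚ :+ con 0ℚ :* b) refl p q)

rational-neg : ∀ p → rational (ℚ.- p) ≃ᶜ -ᶜ rational p
rational-neg p = ≃ᶜ-pointwise (λ _ → refl) (λ _ → refl)

NonNegative : ℂ → Set
NonNegative z = 0ᴿ ≤ᴿ re z × im z ≃ᴿ 0ᴿ

*ᶜ-conj : ∀ z → z *ᶜ conj z ≃ᶜ fromℝ ∣ z ∣²
*ᶜ-conj z = ≃ᶜ-pointwise
  (λ n → solve 2 (λ a b → a :* a :- b :* (:- b) := a :* a :+ b :* b) refl (seq (re z) n)
      (seq (im z) n))
  (λ n → solve 2 (λ a b → a :* (:- b) :+ b :* a := con 0ℚ) refl (seq (re z) n) (seq (im z) n))

0≤∣∣² : ∀ z → 0ᴿ ≤ᴿ ∣ z ∣²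
0≤∣∣² z = 0≤ᴿ-pointwise (λ n → ℚ.+-mono-≤ (0≤p*p (seq (re z) n)) (0≤p*p (seq (im z) n)))

nonNegative-*ᶜ-conj : ∀ z → NonNegative (z *ᶜ conj z)
nonNegative-*ᶜ-conj z = 0≤ᴿ-resp (≃-sym (_≃ᶜ_.re-≃ (*ᶜ-conj z))) (0≤∣∣² z) , _≃ᶜ_.im-≃ (*ᶜ-conj z)

∣∣²-definite : ∀ z → z *ᶜ conj z ≃ᶜ 0ᶜ → z ≃ᶜ 0ᶜ
∣∣²-definite z zz⋆≃0 = mk≃ᶜ
  (square-≃0 (0≤ᴿ-vanish (square-nonNeg (re z)) (square-nonNeg (im z)) ∣z∣²≃0))
  (square-≃0 (0≤ᴿ-vanish (square-nonNeg (im z)) (square-nonNeg (re z)) (≃-trans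
    (pointwise (λ n → ℚ.+-comm (seq (im z *ᴿ im z) n) (seq (re z *ᴿ re z) n))) ∣z∣²≃0)))
  where
  ∣z∣²≃0 : ∣ z ∣² ≃ᴿ 0ᴿ
  ∣z∣²≃0 = _≃ᶜ_.re-≃ (ℂᴿ.trans (ℂᴿ.sym (*ᶜ-conj z)) zz⋆≃0)
  square-nonNeg : ∀ a → 0ᴿ ≤ᴿ a *ᴿ a
  square-nonNeg a = 0≤ᴿ-pointwise (λ n → 0≤p*p (seq a n))

-- The imaginary part is b = (b - (-b))/2, and replacing the first b by -b gives zero.
self-conjugate⇒real : ∀ z → conj z ≃ᶜ z → z ≃ᶜ fromℝ (re z)
self-conjugate⇒real z (mk≃ᶜ _ -b≃b) = mk≃ᶜ ≃-refl (≃-trans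
  (pointwise (λ n → solve 1 (λ b → b := con ½ :* (b :- (:- b))) refl (seq (im z) n)))
  (≃-trans (*ᴿ-cong {fromℚ ½} {y = im z -ᴿ (-ᴿ im z)} ≃-refl
      (+ᴿ-cong {y = -ᴿ (-ᴿ im z)} (≃-sym -b≃b) ≃-refl))
    (pointwise (λ n → solve 1 (λ b → con ½ :* (:- b :- (:- b)) := con 0ℚ) refl (seq (im z) n)))))

-- `positive-+` splits off one summand at a time; the search cannot run out, since the empty sum is
-- 0 and not positive.
positive-summand : ∀ {n} (f : Vector ℂ n) → Positive (re (∑ᶜ f)) → ∃[ i ] Positive (re (f i))
positive-summand {zero} f (η , 0<η , N , η≤0) = contradiction (ℚ.<-≤-trans 0<η (η≤0 ℕ.≤-refl))
    (ℚ.<-irrefl refl)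
positive-summand {suc n} f ∑>0 = [ zero ,_ , (λ ∑>0′ → let i , fᵢ>0 = positive-summand (f ∘ suc) ∑>0′ in suc i , fᵢ>0) ]′
  (positive-+ (re (f zero)) (re (∑ᶜ (f ∘ suc))) ∑>0)

-- The reciprocal is taken before the root: x may have negative terms early on, whereas its
-- reciprocal is nonnegative at every index.
inverse-sqrt : ∀ {x} → Positive x → ∃[ c ] c *ᴿ c *ᴿ x ≃ᴿ 1ᴿ
inverse-sqrt x>0 =
  let y , 0≤y , yx≃1 = reciprocalᴿ x>0
      c , c²≃y = sqrtᴿ y 0≤y
  in c , ≃-trans (*ᴿ-cong c²≃y ≃-refl) yx≃1

pivotᶜ : ∀ {n} (f : Vector ℂ n) → (∀ i → conj (f i) ≃ᶜ f i) →
  ∀ r → ∑ᶜ f ≃ᶜ rational (fromℤ (+ suc r)) →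
  ∃₂ λ i c → conj c ≃ᶜ c × (c *ᶜ c) *ᶜ f i ≃ᶜ rational (fromℤ 1ℤ)
pivotᶜ f f-real r ∑f≃ =
  -- The real part of the sum is equivalent to the constant sequence r + 1, so r + 1 itself serves
  -- as η.
  let i , fᵢ>0 = positive-summand f (positive-resp (≃-sym (_≃ᶜ_.re-≃ ∑f≃))
                   (fromℕ (suc r) , 0<fromℕ-suc r , 0 , λ _ → ℚ.≤-refl))
      c , c²fᵢ≃1 = inverse-sqrt fᵢ>0
      a = re (f i)
  in i , fromℝ c , conj-fromℝ c , ℂᴿ.trans
       (ℂᴿ.*-cong (ℂᴿ.sym (fromℝ-* c c)) (self-conjugate⇒real (f i) (f-real i)))
       (ℂᴿ.trans (ℂᴿ.sym (fromℝ-* (c *ᴿ c) a)) (fromℝ-cong c²fᵢ≃1))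

ℂ-complexNumbers : ComplexNumbers
ℂ-complexNumbers = record
  { commutativeRing = ℂ-commutativeRing
  ; _⋆ = conj
  ; ⋆-cong = λ (mk≃ᶜ p q) → mk≃ᶜ p (-ᴿ-cong q)
  ; ⋆-+ = λ x y → ≃ᶜ-pointwise (λ _ → refl) (λ n → ℚ.neg-distrib-+ (seq (im x) n) (seq (im y) n))
  ; ⋆-* = λ x y → ≃ᶜ-pointwise
      (λ n → solve 4 (λ a b c d → a :* c :- b :* d := a :* c :- (:- b) :* (:- d)) refl
               (seq (re x) n) (seq (im x) n) (seq (re y) n) (seq (im y) n))
      (λ n → solve 4 (λ a b c d → :- (a :* d :+ b :* c) := a :* (:- d) :+ (:- b) :* c) refl
               (seq (re x) n) (seq (im x) n) (seq (re y) n) (seq (im y) n))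
  ; ⋆-⋆ = λ x → ≃ᶜ-pointwise (λ _ → refl) (λ n → solve 1 (λ b → :- (:- b) := b) refl (seq (im x) n))
  ; int = λ a → rational (fromℤ a)
  ; int-+ = λ a b → ℂᴿ.trans (rational-cong (fromℤ-+ a b)) (rational-+ (fromℤ a) (fromℤ b))
  ; int-* = λ a b → ℂᴿ.trans (rational-cong (fromℤ-* a b)) (rational-* (fromℤ a) (fromℤ b))
  ; int-neg = λ a → ℂᴿ.trans (rational-cong (fromℤ-neg a)) (rational-neg (fromℤ a))
  ; int-0 = ℂᴿ.refl
  ; int-1 = ℂᴿ.refl
  ; int-⋆ = λ a → conj-fromℝ (fromℚ (fromℤ a))
  ; imag = 0ᴿ +i 1ᴿ
  ; imag² = ≃ᶜ-pointwise (λ _ → refl) (λ _ → refl)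
  ; imag-⋆ = ≃ᶜ-pointwise (λ _ → refl) (λ _ → refl)
  ; NonNeg = NonNegative
  ; nonNeg-resp = λ (mk≃ᶜ p q) (0≤x , y≃0) → 0≤ᴿ-resp p 0≤x , ≃-trans (≃-sym q) y≃0
  ; nonNeg-+ = λ (0≤x , x≃0) (0≤y , y≃0) → 0≤ᴿ-+ 0≤x 0≤y , ≃-trans (+ᴿ-cong x≃0 y≃0)
      (pointwise (λ _ → refl))
  ; nonNeg-⋆ = nonNegative-*ᶜ-conj
  ; vanish = λ (0≤x , x≃0) (0≤y , _) x+y≃0 → mk≃ᶜ (0≤ᴿ-vanish 0≤x 0≤y (_≃ᶜ_.re-≃ x+y≃0)) x≃0
  ; definite = ∣∣²-definite
  ; pivot = pivotᶜ
  }

rational-sqrt : ∀ {q} → 0ℚ ℚ.≤ q → ∃[ s ] conj s ≃ᶜ s × s *ᶜ s ≃ᶜ rational q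
rational-sqrt {q} 0≤q =
  let s , s²≃q = sqrtᴿ (fromℚ q) (λ _ → 0≤q)
  in fromℝ s , conj-fromℝ s , ℂᴿ.trans (ℂᴿ.sym (fromℝ-* s s)) (fromℝ-cong s²≃q)

-- The Welch bound at redundancy two and the assembly of the frame

fromℕ-*-/ : ∀ i m .{{_ : NonZero m}} → fromℕ m ℚ.* (i ℚ./ m) ≡ fromℤ i
fromℕ-*-/ i (suc m) = ℚ.toℚᵘ-injective (ℚᵘ.≃-trans (ℚ.toℚᵘ-homo-* (fromℕ (suc m)) (i ℚ./ suc m))
  (ℚᵘ.≃-trans (ℚᵘ.*-cong (fromℤ-toℚᵘ (+ suc m)) (ℚ.toℚᵘ-fromℚᵘ (ℚᵘ.mkℚᵘ i m)))
  (ℚᵘ.≃-trans (ℚᵘ.*≡* (trans (ℤ.*-identityʳ _)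
      (trans (ℤ.*-comm (+ suc m) i) (cong (λ k → i ℤ.* + suc k) (sym (ℕ.+-identityʳ m))))))
  (ℚᵘ.≃-sym (fromℤ-toℚᵘ i)))))

-- For n = 2d the numerator n - d is d and cancels against the denominator d (n - 1), which leaves
-- 1/(n - 1).
welchBound²-2d : ∀ d n .{{_ : NonZero d}} .{{_ : NonTrivial n}} → n ≡ 2 ℕ.* d →
  fromℕ (n ℕ.∸ 1) ℚ.* welchBound² d n ≡ 1ℚ
welchBound²-2d d@(suc d-1) n n≡2d =
  let D , 0<D , dD≡1 = reciprocal (0<fromℕ-suc d-1)
      w = welchBound² d n
      k = fromℕ (n ℕ.∸ 1)
      open ≡.≡-Reasoning
  in begin
    k ℚ.* w                          ≡⟨ ℚ.*-identityˡ _ ⟨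
    1ℚ ℚ.* (k ℚ.* w)                 ≡⟨ cong (ℚ._* (k ℚ.* w)) dD≡1 ⟨
    fromℕ d ℚ.* D ℚ.* (k ℚ.* w)      ≡⟨ solve 4 (λ d e k w → d :* e :* (k :* w)
        := e :* (d :* k :* w)) refl (fromℕ d) D k w ⟩
    D ℚ.* (fromℕ d ℚ.* k ℚ.* w)      ≡⟨ cong (λ t → D ℚ.* (t ℚ.* w))
        (trans (cong fromℤ (ℤ.pos-* d (n ℕ.∸ 1))) (fromℤ-* (+ d) (+ (n ℕ.∸ 1)))) ⟨
    D ℚ.* (fromℕ (d ℕ.* (n ℕ.∸ 1)) ℚ.* w)
                                     ≡⟨ cong (D ℚ.*_) (fromℕ-*-/ (+ n ℤ.- + d) (d ℕ.* (n ℕ.∸ 1))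
                                          {{_}}) ⟩
    D ℚ.* fromℤ (+ n ℤ.- + d)        ≡⟨ cong (λ t → D ℚ.* fromℤ t) n-d≡d ⟩
    D ℚ.* fromℕ d                    ≡⟨ trans (ℚ.*-comm D (fromℕ d)) dD≡1 ⟩
    1ℚ                               ∎
  where
  n-d≡d : + n ℤ.- + d ≡ + d
  n-d≡d = trans (cong (λ t → t ℤ.- + d) (trans
      (cong +_ (trans n≡2d (cong (d ℕ.+_) (ℕ.+-identityʳ d)))) (ℤ.pos-+ d d)))
    (trans (ℤ.+-assoc (+ d) (+ d) (ℤ.- + d)) (trans (cong (λ t → + d ℤ.+ t) (ℤ.+-inverseʳ (+ d)))
        (ℤ.+-identityʳ (+ d))))

fromℕ-∸1 : ∀ n .{{_ : NonTrivial n}} → fromℕ n ≡ 1ℚ ℚ.+ fromℕ (n ℕ.∸ 1)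
fromℕ-∸1 (suc n) = fromℕ-suc n

unit-multiple-nonNeg : ∀ n {q} → fromℕ n ℚ.* q ≡ 1ℚ → 0ℚ ℚ.≤ q
unit-multiple-nonNeg n {q} nq≡1 with ℚ.≤-total 0ℚ q
... | inj₁ 0≤q = 0≤q
... | inj₂ q≤0 = contradiction (ℚ.<-≤-trans (ℚ.positive⁻¹ 1ℚ) (begin
    1ℚ                 ≡⟨ nq≡1 ⟨
    fromℕ n ℚ.* q      ≤⟨ ℚ.*-monoˡ-≤-nonNeg (fromℕ n) {{ℚ.nonNegative (0≤fromℕ n)}} q≤0 ⟩
    fromℕ n ℚ.* 0ℚ     ≡⟨ ℚ.*-zeroʳ (fromℕ n) ⟩
    0ℚ                 ∎)) (ℚ.<-irrefl refl)
  where open ℚ.≤-Reasoning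

distinct : ∀ n .{{_ : NonTrivial n}} → ∃₂ λ (i j : Fin n) → i ≢ j
distinct (suc (suc n)) = zero , suc zero , λ ()

equiangular⇒ETF : ∀ {d n} .{{_ : NonZero d}} .{{_ : NonTrivial n}} (y : Fin n → Vector ℂ d) →
  (∀ p → ⟨ y p , y p ⟩ ≃ᶜ 1ᶜ) →
  (∀ {p q} → p ≢ q → ⟨ y p , y q ⟩ *ᶜ conj ⟨ y p , y q ⟩ ≃ᶜ rational (welchBound² d n)) → ETF d n
equiangular⇒ETF {d} {n} {{d≢0}} y y-unit y-norm =
  let p , q , p≢q = distinct n
  in y , record
    -- The instances at hand are irrelevant but the fields are not, so both are rebuilt from
    -- propositions that irrelevant evidence can prove.
    { d≥1   = ℕ.≢-nonZero (ℕ.≢-nonZero⁻¹ d)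
    ; n≥2   = ℕ.n>1⇒nonTrivial (ℕ.nonTrivial⇒n>1 n)
    ; unit  = y-unit
    ; welch = record
      { attained   = (p , q , p≢q) , norm p≢q
      ; upperBound = λ (p , q , p≢q) → ≃⇒≤ᴿ (norm p≢q)
      }
    }
  where
  norm : ∀ {p q} → p ≢ q → ∣ ⟨ y p , y q ⟩ ∣² ≃ᴿ fromℚ (welchBound² d n)
  norm {p} {q} p≢q = _≃ᶜ_.re-≃ (ℂᴿ.trans (ℂᴿ.sym (*ᶜ-conj ⟨ y p , y q ⟩)) (y-norm p≢q))

≤ᴿ⇒nonNegative : ∀ {z q} → ∣ z ∣² ≤ᴿ fromℚ q → NonNegative (rational q +ᶜ -ᶜ (z *ᶜ conj z))
≤ᴿ⇒nonNegative {z} {q} ∣z∣²≤q = ComplexNumbers.nonNeg-resp ℂ-complexNumbers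
  {fromℝ (fromℚ q -ᴿ ∣ z ∣²)} {rational q +ᶜ -ᶜ (z *ᶜ conj z)}
  (ℂᴿ.trans (≃ᶜ-pointwise (λ _ → refl) (λ _ → refl))
      (ℂᴿ.+-congˡ {rational q} (ℂᴿ.-‿cong (ℂᴿ.sym (*ᶜ-conj z)))))
  (≤ᴿ⇒0≤ᴿ- ∣z∣²≤q , ≃-refl)

-- The form in which w = 1/(n - 1) enters the algebra: free of division and of truncated
-- subtraction.
welch-suc : ∀ d n .{{_ : NonZero d}} .{{_ : NonTrivial n}} → n ≡ 2 ℕ.* d →
  rational (fromℕ n) *ᶜ rational (welchBound² d n) ≃ᶜ rational 1ℚ +ᶜ rational (welchBound² d n)
welch-suc d n n≡2d = ℂᴿ.trans (ℂᴿ.sym (rational-* (fromℕ n) w))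
    (ℂᴿ.trans (rational-cong nw≡1+w) (rational-+ 1ℚ w))
  where
  w : ℚ
  w = welchBound² d n
  open ≡.≡-Reasoning
  nw≡1+w : fromℕ n ℚ.* w ≡ 1ℚ ℚ.+ w
  nw≡1+w = begin
    fromℕ n ℚ.* w                          ≡⟨ cong (ℚ._* w) (fromℕ-∸1 n) ⟩
    (1ℚ ℚ.+ fromℕ (n ℕ.∸ 1)) ℚ.* w         ≡⟨ solve 2 (λ k w → (con 1ℚ :+ k) :* w := k :* w
        :+ w) refl (fromℕ (n ℕ.∸ 1)) w ⟩
    fromℕ (n ℕ.∸ 1) ℚ.* w ℚ.+ w            ≡⟨ cong (ℚ._+ w) (welchBound²-2d d n n≡2d) ⟩
    1ℚ ℚ.+ w                               ∎

rational-fromℕ-* : ∀ m n → rational (fromℕ m) *ᶜ rational (fromℕ n) ≃ᶜ rational (fromℕ (m ℕ.* n))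
rational-fromℕ-* m n = ℂᴿ.sym (ℂᴿ.trans
  (rational-cong (trans (cong fromℤ (ℤ.pos-* m n)) (fromℤ-* (+ m) (+ n))))
      (rational-* (fromℕ m) (fromℕ n)))

rational-∸1 : ∀ n .{{_ : NonTrivial n}} q →
  rational (fromℕ (n ℕ.∸ 1) ℚ.* q) ≃ᶜ (rational (fromℕ n) +ᶜ -ᶜ rational 1ℚ) *ᶜ rational q
rational-∸1 n q = ℂᴿ.trans (rational-* (fromℕ (n ℕ.∸ 1)) q) (ℂᴿ.*-congʳ {rational q}
  (ℂᴿ.trans (rational-cong (trans (solve 1 (λ k → k := con 1ℚ :+ k :- con 1ℚ) refl (fromℕ (n ℕ.∸ 1)))
      (cong (ℚ._- 1ℚ) (sym (fromℕ-∸1 n)))))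
  (ℂᴿ.trans (rational-+ (fromℕ n) (ℚ.- 1ℚ)) (ℂᴿ.+-congˡ {rational (fromℕ n)} (rational-neg 1ℚ)))))

-- The sizes are variables tied by equations, because the Kronecker product has n · m vectors, and
-- this product is only propositionally equal to the number wanted.
etf-product : ∀ {d n m r} {A B : Matrix m} .{{_ : NonZero r}} → n ≡ 2 ℕ.* d → n ℕ.* m ≡ 2 ℕ.* r →
  IsAmicable A B → ETF d n → ETF r (n ℕ.* m)
etf-product {d} {n} {m} {r} n≡2d nm≡2r AB (x , x-etf) =
  let y , y-unit , y-norm = frame
  in equiangular⇒ETF y y-unit y-norm
  where
  open Frames ℂ-complexNumbers using (frame-product)
  instance
    d-nonZero : NonZero d
    d-nonZero = IsETF.d≥1 x-etf
    n-nonTrivial : NonTrivial n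
    n-nonTrivial = IsETF.n≥2 x-etf
    nm-nonTrivial : NonTrivial (n ℕ.* m)
    nm-nonTrivial = subst NonTrivial (sym nm≡2r) (ℕ.n>1⇒nonTrivial (ℕ.*-monoʳ-≤ 2 (ℕ.>-nonZero⁻¹ r)))
  w w′ : ℚ
  w  = welchBound² d n
  w′ = welchBound² r (n ℕ.* m)
  0≤w′ : 0ℚ ℚ.≤ w′
  0≤w′ = unit-multiple-nonNeg (n ℕ.* m ℕ.∸ 1) (welchBound²-2d r (n ℕ.* m) nm≡2r)
  0≤kw′ : 0ℚ ℚ.≤ fromℕ (n ℕ.∸ 1) ℚ.* w′
  0≤kw′ = subst (ℚ._≤ fromℕ (n ℕ.∸ 1) ℚ.* w′) (ℚ.*-zeroʳ (fromℕ (n ℕ.∸ 1)))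
    (ℚ.*-monoˡ-≤-nonNeg (fromℕ (n ℕ.∸ 1)) {{ℚ.nonNegative (0≤fromℕ (n ℕ.∸ 1))}} 0≤w′)
  frame : ∃ λ (y : Fin (n ℕ.* m) → Vector ℂ r) → (∀ p → ⟨ y p , y p ⟩ ≃ᶜ rational 1ℚ) ×
    (∀ {p q} → p ≢ q → ⟨ y p , y q ⟩ *ᶜ conj ⟨ y p , y q ⟩ ≃ᶜ rational w′)
  frame =
    let α , α-real , α² = rational-sqrt 0≤kw′
        β , β-real , β² = rational-sqrt 0≤w′
    in frame-product x {rational w} {rational w′} {α} {β} n≡2d nm≡2r AB
      (welch-suc d n n≡2d)
      (ℂᴿ.trans (ℂᴿ.*-congʳ {rational w′} (rational-fromℕ-* n m)) (welch-suc r (n ℕ.* m) nm≡2r))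
      α-real (ℂᴿ.trans α² (rational-∸1 n w′)) β-real β² (IsETF.unit x-etf)
      (λ {i} {j} i≢j → ≤ᴿ⇒nonNegative {⟨ x i , x j ⟩}
          (IsMaximum.upperBound (IsETF.welch x-etf) (i , j , i≢j)))

open import Data.Nat.Base using (_*_)

theorem2 : (N d : ℕ) → .{{_ : NonZero N}} → .{{_ : NonZero d}} →
    AmicablePair (2 * N) → ETF d (2 * d) → ETF (2 * d * N) (4 * d * N)
theorem2 N d (A , B , AB) x = subst (ETF (2 * d * N)) nm≡4dN (etf-product refl nm≡2r AB x)
  where
  open ℕ.+-*-Solver using () renaming (solve to ℕ-solve; con to ℕ-con; _:*_ to _⊗_; _:=_ to _⊜_)
  instance
    r-nonZero : NonZero (2 * d * N)
    r-nonZero = ℕ.m*n≢0 (2 * d) N {{ℕ.m*n≢0 2 d}}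
  nm≡2r : 2 * d * (2 * N) ≡ 2 * (2 * d * N)
  nm≡2r = ℕ-solve 2 (λ d N → ℕ-con 2 ⊗ d ⊗ (ℕ-con 2 ⊗ N) ⊜ ℕ-con 2 ⊗ (ℕ-con 2 ⊗ d ⊗ N)) refl d N
  nm≡4dN : 2 * d * (2 * N) ≡ 4 * d * N
  nm≡4dN = ℕ-solve 2 (λ d N → ℕ-con 2 ⊗ d ⊗ (ℕ-con 2 ⊗ N) ⊜ ℕ-con 4 ⊗ d ⊗ N) refl d N
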